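{- For all $k\in\mathbb{N}$ with $k\ge 2$, every strongly $10^4 k\log k$-connected tournament is $k$-linked.
   Context: A digraph $D$ is strongly $m$-connected if $|D|>m$ and for every $S\subseteq V(D)$ with $|S|\le m-1$, $D-S$ is strongly connected. A digraph $D$ is $k$-linked if $|D|\ge 2k$ and whenever $x_1,\dots,x_k,y_1,\dots,y_k$ are $2k$ distinct vertices of $D$, there exist vertex-disjoint directed paths $P_1,\dots,P_k$ such that $P_i$ is a path from $x_i$ to $y_i$. $\log$ denotes the binary logarithm. -}

module Defs where

open import Data.Nat using (ℕ; suc; _+_; _*_; _^_; _≤_; _<_)
open import Data.Bool using (Bool; true; false; T; _xor_)
open import Data.Fin using (Fin)
open import Data.Fin.Subset using (Subset; ∣_∣)
import Data.Fin.Subset as Sub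
open import Data.List using (List; []; _∷_)
open import Data.List.Relation.Unary.All using (All)
open import Data.List.Relation.Unary.Unique.Propositional using (Unique)
import Data.List.Membership.Propositional as LM
open import Data.Product using (Σ; _×_; ∃)
open import Relation.Nullary using (¬_)
open import Relation.Binary.PropositionalEquality using (_≡_; _≢_)

Digraph : ℕ → Set
Digraph n = Fin n → Fin n → Bool

Arc : ∀ {n} → Digraph n → Fin n → Fin n → Set
Arc D u v = T (D u v)

IsTournament : ∀ {n} → Digraph n → Set
IsTournament {n} D =
  (∀ u → D u u ≡ false) × (∀ u v → u ≢ v → (D u v xor D v u) ≡ true)

data Walk {n} (D : Digraph n) : Fin n → Fin n → List (Fin n) → Set where
  here : ∀ x → Walk D x x (x ∷ [])
  step : ∀ {x y z vs} → Arc D x y → Walk D y z vs → Walk D x z (x ∷ vs)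

IsPath : ∀ {n} → Digraph n → Fin n → Fin n → List (Fin n) → Set
IsPath D x y vs = Walk D x y vs × Unique vs

StronglyConnectedMinus : ∀ {n} → Digraph n → Subset n → Set
StronglyConnectedMinus {n} D S =
  ∀ u v → ¬ (u Sub.∈ S) → ¬ (v Sub.∈ S) →
  ∃ λ vs → IsPath D u v vs × All (λ w → ¬ (w Sub.∈ S)) vs

-- Strongly m-connected for a (possibly real) threshold m, where m is
-- represented by the predicate  le t  meaning  t ≤ m  (for natural t).
-- |D| > m  and  for all S with |S| ≤ m - 1 (i.e. |S| + 1 ≤ m), D - S strongly connected.
StronglyConnected : ∀ {n} → Digraph n → (le : ℕ → Set) → Set
StronglyConnected {n} D le =
  ¬ le n × (∀ (S : Subset n) → le (∣ S ∣ + 1) → StronglyConnectedMinus D S)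

-- t ≤ 10^4 · k · log₂ k  ⇔  2^t ≤ k^(10^4 · k)   (exact, for natural t and k ≥ 1).
LeThreshold : ℕ → ℕ → Set
LeThreshold k t = 2 ^ t ≤ k ^ (10000 * k)

Linked : ∀ {n} → Digraph n → ℕ → Set
Linked {n} D k =
  2 * k ≤ n ×
  (∀ (x y : Fin k → Fin n) →
    (∀ i j → x i ≡ x j → i ≡ j) →
    (∀ i j → y i ≡ y j → i ≡ j) →
    (∀ i j → x i ≢ y j) →
    Σ (Fin k → List (Fin n)) λ P →
      (∀ i → IsPath D (x i) (y i) (P i)) ×
      (∀ i j w → w LM.∈ P i → w LM.∈ P j → i ≡ j))

{-# OPTIONS --safe #-}
module Submission where

-- A vertex v of maximal in-degree is reached from every vertex u of large out-degree by many
-- paths with at most two inner vertices, and this stays true for the t vertices of largest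
-- in-degree (lemma shortPath). Let I consist of the 34k vertices of largest in-degree, L of the
-- vertices of I that are not prescribed, Y of the k vertices of largest in-degree inside L, and X
-- of k further vertices of L with out-degree at least 15k inside L. Each x i is joined to X i by
-- a short path, and dually a vertex o i of very large out-degree is joined to y i. After deletion
-- of what is used so far except Y and the o i, Menger's theorem joins Y to the o i by disjoint
-- paths in some unknown order. That order is corrected inside L, since short paths from the X i
-- to Y can be found in L for every bijection. Connectivity 200k is enough, and
-- 200k ≤ 10⁴ k log k.

open import Defs
open import Data.Bool using (true; false; T; T?)
open import Data.Empty using (⊥-elim)
open import Data.Fin as Fin using (Fin; zero; suc; punchOut)
import Data.Fin.Properties as Finₚ
open import Data.Fin.Subset as Sub using (Subset; ∣_∣)
import Data.Fin.Subset.Properties as Subₚ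
open import Data.List using (List; []; _∷_; _++_; length; filter; lookup; map; concat; tabulate;
  allFin; cartesianProduct; deduplicate)
open import Data.List.Extrema.Nat using (argmax; f[xs]≤f[argmax]; argmax-sel)
import Data.List.Membership.DecPropositional as DecMembership
open import Data.List.Membership.Propositional using (_∈_; _∉_; find; lose)
open import Data.List.Membership.Propositional.Properties
open import Data.List.Properties using (length-++; length-filter; length-tabulate)
open import Data.List.Relation.Binary.Subset.Propositional using (_⊆_)
open import Data.List.Relation.Unary.All as All using (All; []; _∷_)
open import Data.List.Relation.Unary.All.Properties using (¬Any⇒All¬)
open import Data.List.Relation.Unary.Any as Any using (here; there)
open import Data.List.Relation.Unary.Any.Properties using (lookup-index)
import Data.List.Relation.Unary.Unique.DecPropositional.Properties as DecUniqueₚ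
open import Data.List.Relation.Unary.Unique.Propositional using (Unique; []; _∷_)
import Data.List.Relation.Unary.Unique.Propositional.Properties as Uniqueₚ
open import Data.Nat using (ℕ; zero; suc; _+_; _*_; _^_; _≤_; _<_; _≤?_; _<?_; _≤ᵇ_; z≤n; s≤s)
open import Data.Nat.ListAction using (sum)
open import Data.Nat.Properties hiding (_≟_; _≤?_; _<?_)
open import Data.Nat.Tactic.RingSolver using (solve-∀)
open import Data.Product using (Σ; ∃; _×_; _,_; proj₁; proj₂)
open import Data.Sum using (_⊎_; inj₁; inj₂; [_,_]′; swap)
open import Data.Vec using ([]; _∷_)
open import Function using (_∘_; flip)
open import Relation.Binary using (DecidableEquality)
import Relation.Binary as B
open import Relation.Binary.PropositionalEquality
  using (_≡_; _≢_; refl; sym; trans; cong; subst)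
open import Relation.Nullary using (¬_; Dec; yes; no; contradiction; ¬?; _×-dec_; _⊎-dec_)
open import Relation.Unary using (Decidable)

-- Walks over an arbitrary relation, and injections between finite index sets.

data Chain {V : Set} (E : V → V → Set) : V → V → List V → Set where
  [_] : ∀ x → Chain E x x (x ∷ [])
  _∷_ : ∀ {x y z vs} → E x y → Chain E y z vs → Chain E x z (x ∷ vs)

module _ {V : Set} where

  Chain-map : {E F : V → V → Set} → (∀ {u v} → E u v → F u v) →
              ∀ {x y vs} → Chain E x y vs → Chain F x y vs
  Chain-map f [ x ] = [ x ]
  Chain-map f (e ∷ c) = f e ∷ Chain-map f c

  Chain-head : {E : V → V → Set} → ∀ {x y vs} → Chain E x y vs → x ∈ vs
  Chain-head [ x ] = here refl
  Chain-head (_ ∷ _) = here refl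

  Chain-last : {E : V → V → Set} → ∀ {x y vs} → Chain E x y vs → y ∈ vs
  Chain-last [ x ] = here refl
  Chain-last (_ ∷ c) = there (Chain-last c)

  -- The vertex list of the composite is bounded by inclusion only: it lists the junction once,
  -- `vs ++ ws` twice, and later arguments use membership alone.
  _⁀_ : {E : V → V → Set} → ∀ {x y z vs ws} → Chain E x y vs → Chain E y z ws →
        ∃ λ us → Chain E x z us × us ⊆ vs ++ ws
  [ x ] ⁀ d = _ , d , there
  (e ∷ c) ⁀ d with c ⁀ d
  ... | us , cd , us⊆ = _ , e ∷ cd , λ { (here refl) → here refl ; (there p) → there (us⊆ p) }

lookup-injective : {A : Set} {xs : List A} → Unique xs →
                   ∀ i j → lookup xs i ≡ lookup xs j → i ≡ j
lookup-injective (_ ∷ _) zero zero _ = refl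
lookup-injective {xs = _ ∷ xs} (x≢ ∷ _) zero (suc j) eq =
  contradiction eq (All.lookup x≢ (∈-lookup {xs = xs} j))
lookup-injective {xs = _ ∷ xs} (x≢ ∷ _) (suc i) zero eq =
  contradiction (sym eq) (All.lookup x≢ (∈-lookup {xs = xs} i))
lookup-injective (_ ∷ u) (suc i) (suc j) eq = cong suc (lookup-injective u i j eq)

pick : {V : Set} → ∀ {k} {xs : List V} → Unique xs → k ≤ length xs →
       Σ (Fin k → V) λ f → (∀ i j → f i ≡ f j → i ≡ j) × (∀ i → f i ∈ xs)
pick {xs = xs} uxs k≤ =
  (λ i → lookup xs (Fin.inject≤ i k≤)) ,
  (λ i j eq → Finₚ.inject≤-injective k≤ k≤ i j (lookup-injective uxs _ _ eq)) ,
  λ i → ∈-lookup (Fin.inject≤ i k≤)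

Disjoint : {I V : Set} → (I → List V) → Set
Disjoint P = ∀ i j w → w ∈ P i → w ∈ P j → i ≡ j

-- If `c` were missed, punching it out of the values would inject `Fin (suc k)` into `Fin k`.
injective⇒surjective : ∀ {k} (f : Fin k → Fin k) → (∀ i j → f i ≡ f j → i ≡ j) →
                       ∀ c → ∃ λ i → f i ≡ c
injective⇒surjective {suc k} f inj c with Finₚ.any? (λ i → f i Fin.≟ c)
... | yes hit = hit
... | no miss = contradiction
  (Finₚ.injective⇒≤ {f = λ i → punchOut {i = c} {j = f i} (λ eq → miss (i , sym eq))}
    (λ {i} {j} eq → inj i j (Finₚ.punchOut-injective {i = c} _ _ eq)))
  (≤⇒≯ ≤-refl)

-- Menger's theorem for two vertex sets.

module Menger {V : Set} (_≟_ : DecidableEquality V) where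

  open DecMembership _≟_ using (_∈?_)

  record Linkage (E : V → V → Set) (A B : List V) (k : ℕ) : Set where
    field
      from to  : Fin k → V
      path     : Fin k → List V
      chain    : ∀ i → Chain E (from i) (to i) (path i)
      from∈    : ∀ i → from i ∈ A
      to∈      : ∀ i → to i ∈ B
      disjoint : Disjoint path

  -- A separator of fewer than k vertices, certified by the set of vertices on the A-side.
  record Separation (E : V → V → Set) (A B : List V) (k : ℕ) : Set₁ where
    field
      Side      : V → Set
      side?     : Decidable Side
      cut       : List V
      small     : length cut < k
      side∌cut  : ∀ {u} → Side u → u ∉ cut
      A-side    : ∀ {u} → u ∈ A → u ∈ cut ⊎ Side u
      B-side    : ∀ {u} → u ∈ B → ¬ Side u
      closed    : ∀ {u v} → Side u → E u v → v ∈ cut ⊎ Side v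

  ArcIn : List (V × V) → V → V → Set
  ArcIn es u v = (u , v) ∈ es

  module _ {E : V → V → Set} {Side : V → Set} {S : List V} where

    -- The walk is cut at its first vertex in `x ∷ S`. Before that it cannot leave `Side`, because
    -- an arc out of `Side` ends in `Side` or in `S`.
    prefix : ∀ {x a b vs} → (∀ {u v} → Side u → E u v → v ∈ S ⊎ Side v) →
             a ∈ S ⊎ Side a → b ∈ x ∷ S → Chain E a b vs →
             ∃ λ b′ → ∃ λ vs′ → Chain E a b′ vs′ × b′ ∈ x ∷ S × vs′ ⊆ vs ×
               (∀ {w} → w ∈ vs′ → w ≡ b′ ⊎ Side w)
    prefix {x} {a} cl a∈ b∈ c with a ∈? (x ∷ S)
    ... | yes a∈xS = a , _ , [ a ] , a∈xS , (λ { (here refl) → Chain-head c }) ,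
                     λ { (here refl) → inj₁ refl }
    ... | no a∉xS with c
    ...   | [ _ ] = ⊥-elim (a∉xS b∈)
    ...   | e ∷ c′ with a∈
    ...     | inj₁ a∈S = ⊥-elim (a∉xS (there a∈S))
    ...     | inj₂ sa with prefix cl (cl sa e) b∈ c′
    ...       | b′ , vs′ , c″ , b′∈ , vs′⊆ , loc =
                b′ , _ , e ∷ c″ , b′∈ ,
                (λ { (here p) → here p ; (there p) → there (vs′⊆ p) }) ,
                λ { (here refl) → inj₂ sa ; (there p) → loc p }

    -- Read from its end, the walk has either shown its last vertex in `y ∷ S`, or all of it so far
    -- avoids both `Side` and `y ∷ S`. The second case carries the recursion; `suffix` excludes it
    -- for walks that start in `y ∷ S`.
    suffix′ : ∀ {y a b vs} → Decidable Side → (∀ {u v} → Side u → E u v → v ∈ S ⊎ Side v) →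
              ¬ Side b → Chain E a b vs →
              (∃ λ a′ → ∃ λ vs′ → Chain E a′ b vs′ × a′ ∈ y ∷ S × vs′ ⊆ vs ×
                (∀ {w} → w ∈ vs′ → w ≡ a′ ⊎ (¬ Side w × w ∉ y ∷ S)))
              ⊎ (∀ {w} → w ∈ vs → ¬ Side w × w ∉ y ∷ S)
    suffix′ {y} side? cl ¬b [ b ] with b ∈? (y ∷ S)
    ... | yes b∈ = inj₁ (b , _ , [ b ] , b∈ , (λ p → p) , λ { (here refl) → inj₁ refl })
    ... | no b∉ = inj₂ λ { (here refl) → ¬b , b∉ }
    suffix′ {y} {a} side? cl ¬b (e ∷ c) with suffix′ {y} side? cl ¬b c
    ... | inj₁ (a′ , vs′ , c′ , a′∈ , vs′⊆ , loc) =
          inj₁ (a′ , vs′ , c′ , a′∈ , there ∘ vs′⊆ , loc)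
    ... | inj₂ out with a ∈? (y ∷ S)
    ...   | yes a∈ = inj₁ (a , _ , e ∷ c , a∈ , (λ p → p) ,
                           λ { (here refl) → inj₁ refl ; (there p) → inj₂ (out p) })
    ...   | no a∉ with side? a
    ...     | no ¬a = inj₂ λ { (here refl) → ¬a , a∉ ; (there p) → out p }
    ...     | yes sa with cl sa e | out (Chain-head c)
    ...       | inj₁ v∈S | _ , v∉ = ⊥-elim (v∉ (there v∈S))
    ...       | inj₂ sv  | ¬v , _ = ⊥-elim (¬v sv)

    suffix : ∀ {y a b vs} → Decidable Side → (∀ {u v} → Side u → E u v → v ∈ S ⊎ Side v) →
             a ∈ y ∷ S → ¬ Side b → Chain E a b vs →
             ∃ λ a′ → ∃ λ vs′ → Chain E a′ b vs′ × a′ ∈ y ∷ S × vs′ ⊆ vs ×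
               (∀ {w} → w ∈ vs′ → w ≡ a′ ⊎ (¬ Side w × w ∉ y ∷ S))
    suffix {y} side? cl a∈ ¬b c with suffix′ {y} side? cl ¬b c
    ... | inj₁ res = res
    ... | inj₂ out = ⊥-elim (proj₂ (out (Chain-head c)) a∈)

  module _ {es : List (V × V)} {A B : List V} {k : ℕ} {x y : V}
           (sep : Separation (ArcIn es) A B k) where

    open Separation sep

    private E′ = ArcIn ((x , y) ∷ es)

    -- The new arc matters only if it runs from `Side` to a vertex outside both `Side` and `cut`.
    uncut⇒Separation : ¬ (Side x × y ∉ cut × ¬ Side y) → Separation E′ A B k
    uncut⇒Separation nocross = record
      { Side = Side ; side? = side? ; cut = cut ; small = small ; side∌cut = side∌cut
      ; A-side = A-side ; B-side = B-side
      ; closed = λ { {v = v} su (here refl) → decide su ; su (there e) → closed su e } }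
      where
        decide : Side x → y ∈ cut ⊎ Side y
        decide sx with y ∈? cut | side? y
        ... | yes p | _ = inj₁ p
        ... | _ | yes p = inj₂ p
        ... | no p | no q = ⊥-elim (nocross (sx , p , q))

    -- The new arc starts at `x`, a target of `left`, hence outside `L.Side`. The vertices of `cut`
    -- are targets too, so the intersection of the two sides can be left only through `L.cut`.
    leftSeparation : Separation (ArcIn es) A (x ∷ cut) k → Separation E′ A B k
    leftSeparation left = record
      { Side = λ v → Side v × L.Side v ; side? = λ v → side? v ×-dec L.side? v
      ; cut = L.cut ; small = L.small ; side∌cut = λ (_ , s) → L.side∌cut s
      ; A-side = λ a∈ → meet (A-side a∈) (L.A-side a∈)
      ; B-side = λ b∈ (s , _) → B-side b∈ s
      ; closed = λ { (_ , s) (here refl) → ⊥-elim (L.B-side (here refl) s)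
                   ; (s , t) (there e) → meet (closed s e) (L.closed t e) } }
      where
        module L = Separation left
        meet : ∀ {v} → v ∈ cut ⊎ Side v → v ∈ L.cut ⊎ L.Side v → v ∈ L.cut ⊎ (Side v × L.Side v)
        meet _ (inj₁ p) = inj₁ p
        meet (inj₁ p) (inj₂ q) = ⊥-elim (L.B-side (there p) q)
        meet (inj₂ p) (inj₂ q) = inj₂ (p , q)

    -- Dually the sides are united. Leaving `Side`, through `cut` or along the new arc, leads to a
    -- source of `right`, which is in `R.Side` or `R.cut`. The vertices of `R.cut` are taken out
    -- because `Side` may contain some.
    rightSeparation : Separation (ArcIn es) (y ∷ cut) B k → Separation E′ A B k
    rightSeparation right = record
      { Side = λ v → (Side v ⊎ R.Side v) × v ∉ R.cut
      ; side? = λ v → (side? v ⊎-dec R.side? v) ×-dec ¬? (v ∈? R.cut)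
      ; cut = R.cut ; small = R.small ; side∌cut = proj₂
      ; A-side = λ a∈ → [ fromCut , join ∘ inj₁ ]′ (A-side a∈)
      ; B-side = λ { b∈ (inj₁ s , _) → B-side b∈ s ; b∈ (inj₂ s , _) → R.B-side b∈ s }
      ; closed = λ { _ (here refl) → [ inj₁ , join ∘ inj₂ ]′ (R.A-side (here refl))
                   ; (inj₁ s , _) (there e) → [ fromCut , join ∘ inj₁ ]′ (closed s e)
                   ; (inj₂ s , _) (there e) → [ inj₁ , join ∘ inj₂ ]′ (R.closed s e) } }
      where
        module R = Separation right
        join : ∀ {v} → Side v ⊎ R.Side v → v ∈ R.cut ⊎ ((Side v ⊎ R.Side v) × v ∉ R.cut)
        join {v} s with v ∈? R.cut
        ... | yes p = inj₁ p
        ... | no p = inj₂ (s , p)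
        fromCut : ∀ {v} → v ∈ cut → v ∈ R.cut ⊎ ((Side v ⊎ R.Side v) × v ∉ R.cut)
        fromCut v∈ = [ inj₁ , join ∘ inj₂ ]′ (R.A-side (there v∈))

    private
      -- Paths stopped at their first vertex in cut ∪ {x}, resp. started at their last one in cut ∪ {y}.
      record Prefixes : Set where
        field
          from end : Fin k → V
          path     : Fin k → List V
          chain    : ∀ i → Chain (ArcIn es) (from i) (end i) (path i)
          from∈    : ∀ i → from i ∈ A
          end∈     : ∀ i → end i ∈ x ∷ cut
          disjoint : Disjoint path
          place    : ∀ i {w} → w ∈ path i → w ≡ end i ⊎ Side w

        end-injective : ∀ i j → end i ≡ end j → i ≡ j
        end-injective i j eq = disjoint i j (end i) (Chain-last (chain i))
          (subst (_∈ path j) (sym eq) (Chain-last (chain j)))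

      record Suffixes : Set where
        field
          start to : Fin k → V
          path     : Fin k → List V
          chain    : ∀ i → Chain (ArcIn es) (start i) (to i) (path i)
          start∈   : ∀ i → start i ∈ y ∷ cut
          to∈      : ∀ i → to i ∈ B
          disjoint : Disjoint path
          place    : ∀ i {w} → w ∈ path i → w ≡ start i ⊎ (¬ Side w × w ∉ y ∷ cut)

        start-injective : ∀ i j → start i ≡ start j → i ≡ j
        start-injective i j eq = disjoint i j (start i) (Chain-head (chain i))
          (subst (_∈ path j) (sym eq) (Chain-head (chain j)))

      prefixes : Linkage (ArcIn es) A (x ∷ cut) k → Prefixes
      prefixes l = record
        { from = from ; end = λ i → proj₁ (pre i) ; path = λ i → proj₁ (proj₂ (pre i))
        ; chain = λ i → proj₁ (proj₂ (proj₂ (pre i))) ; from∈ = from∈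
        ; end∈ = λ i → proj₁ (proj₂ (proj₂ (proj₂ (pre i))))
        ; disjoint = λ i j w p q → disjoint i j w (sub i p) (sub j q)
        ; place = λ i → proj₂ (proj₂ (proj₂ (proj₂ (proj₂ (pre i))))) }
        where
          open Linkage l
          pre : ∀ i → _
          pre i = prefix {S = cut} {x = x} closed (A-side (from∈ i)) (to∈ i) (chain i)
          sub : ∀ i → proj₁ (proj₂ (pre i)) ⊆ path i
          sub i = proj₁ (proj₂ (proj₂ (proj₂ (proj₂ (pre i)))))

      suffixes : Linkage (ArcIn es) (y ∷ cut) B k → Suffixes
      suffixes l = record
        { start = λ i → proj₁ (suf i) ; to = to ; path = λ i → proj₁ (proj₂ (suf i))
        ; chain = λ i → proj₁ (proj₂ (proj₂ (suf i))) ; to∈ = to∈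
        ; start∈ = λ i → proj₁ (proj₂ (proj₂ (proj₂ (suf i))))
        ; disjoint = λ i j w p q → disjoint i j w (sub i p) (sub j q)
        ; place = λ i → proj₂ (proj₂ (proj₂ (proj₂ (proj₂ (suf i))))) }
        where
          open Linkage l
          suf : ∀ i → _
          suf i = suffix {S = cut} {y = y} side? closed (from∈ i) (B-side (to∈ i)) (chain i)
          sub : ∀ i → proj₁ (proj₂ (suf i)) ⊆ path i
          sub i = proj₁ (proj₂ (proj₂ (proj₂ (proj₂ (suf i)))))

      module _ (left : Prefixes) (right : Suffixes) where

        private
          module L = Prefixes left
          module R = Suffixes right

        Matching : Set
        Matching = Σ (Fin k → Fin k) λ σ → (∀ i j → σ i ≡ σ j → i ≡ j) ×
          (∀ i → (L.end i ≡ x × R.start (σ i) ≡ y) ⊎ (L.end i ≡ R.start (σ i)))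

        -- `x ∷ cut` and `y ∷ cut` share their tail, so ends and starts are matched by list
        -- position: at position 0 the new arc joins them, elsewhere they coincide. The `k` starts
        -- have distinct positions below `k`, as `small` is `suc (length cut) ≤ k`, so the position
        -- of every end is hit.
        matching : Matching
        matching = (λ i → proj₁ (matched i)) , injective , λ i → link (L.end∈ i) (R.start∈ _) (σ-index i)
          where
            index-injective : ∀ {S : List V} {u v} (p : u ∈ S) (q : v ∈ S) →
                              Any.index p ≡ Any.index q → u ≡ v
            index-injective {S} p q eq =
              trans (lookup-index p) (trans (cong (lookup S) eq) (sym (lookup-index q)))

            position : ∀ {S : List V} {v} → length S ≤ k → v ∈ S → Fin k
            position S≤k p = Fin.inject≤ (Any.index p) S≤k

            matched : ∀ i → ∃ λ j → position small (R.start∈ j) ≡ position small (L.end∈ i)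
            matched i = injective⇒surjective (λ j → position small (R.start∈ j))
              (λ i j eq → R.start-injective i j
                (index-injective (R.start∈ i) (R.start∈ j) (Finₚ.inject≤-injective small small _ _ eq)))
              (position small (L.end∈ i))

            σ-index : ∀ i → Any.index (R.start∈ (proj₁ (matched i))) ≡ Any.index (L.end∈ i)
            σ-index i = Finₚ.inject≤-injective small small _ _ (proj₂ (matched i))

            injective : ∀ i j → proj₁ (matched i) ≡ proj₁ (matched j) → i ≡ j
            injective i j eq = L.end-injective i j (index-injective (L.end∈ i) (L.end∈ j)
              (trans (sym (σ-index i)) (trans (cong (λ l → Any.index (R.start∈ l)) eq) (σ-index j))))

            link : ∀ {u v} (p : u ∈ x ∷ cut) (q : v ∈ y ∷ cut) → Any.index q ≡ Any.index p →
                   (u ≡ x × v ≡ y) ⊎ u ≡ v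
            link (here p) (here q) _ = inj₁ (p , q)
            link (there p) (there q) eq = inj₂ (index-injective p q (sym (Finₚ.suc-injective eq)))

        glue : Side x → y ∉ cut → ¬ Side y → Matching → Linkage E′ A B k
        glue sx y∉ ¬y (σ , σ-injective , link) = record
          { from = L.from ; to = R.to ∘ σ
          ; path = λ i → proj₁ (joined i) ; chain = λ i → proj₁ (proj₂ (joined i))
          ; from∈ = L.from∈ ; to∈ = R.to∈ ∘ σ
          ; disjoint = λ i j w p q →
              meet i j (proj₂ (proj₂ (joined i)) p) (proj₂ (proj₂ (joined j)) q) }
          where
            join : ∀ {a u v b vs ws} → Chain (ArcIn es) a u vs → Chain (ArcIn es) v b ws →
                   (u ≡ x × v ≡ y) ⊎ u ≡ v → ∃ λ us → Chain E′ a b us × us ⊆ vs ++ ws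
            join c d (inj₂ refl) = Chain-map there c ⁀ Chain-map there d
            join {vs = vs} c d (inj₁ (refl , refl))
              with Chain-map there c ⁀ (here refl ∷ Chain-map there d)
            ... | us , cd , us⊆ = us , cd , λ p → [ ∈-++⁺ˡ , tail ]′ (∈-++⁻ vs (us⊆ p))
              where
                tail : ∀ {w ws} → w ∈ x ∷ ws → w ∈ vs ++ ws
                tail (here refl) = ∈-++⁺ˡ (Chain-last c)
                tail (there p) = ∈-++⁺ʳ vs p

            joined : ∀ i → ∃ λ us → Chain E′ (L.from i) (R.to (σ i)) us × us ⊆ L.path i ++ R.path (σ i)
            joined i = join (L.chain i) (R.chain (σ i)) (link i)

            side∌start : ∀ {w} → Side w → w ∉ y ∷ cut
            side∌start s (here refl) = ¬y s
            side∌start s (there t) = side∌cut s t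

            -- Suffixes have no vertex in `Side`, since their starts are `y` or in `cut`. A common
            -- vertex is therefore the end of the prefix, lies in `cut`, and is the start of the
            -- suffix, so the matching pairs the two.
            cross : ∀ i j {w} → w ∈ L.path i → w ∈ R.path (σ j) → i ≡ j
            cross i j p q with L.place i p | R.place (σ j) q | L.end∈ i | link j
            ... | inj₂ s    | inj₂ (¬s , _)  | _       | _ = ⊥-elim (¬s s)
            ... | inj₂ s    | inj₁ refl      | _       | _ = ⊥-elim (side∌start s (R.start∈ (σ j)))
            ... | inj₁ refl | inj₂ (¬s , _)  | here ex | _ = ⊥-elim (¬s (subst Side (sym ex) sx))
            ... | inj₁ refl | inj₂ (_ , w∉)  | there t | _ = ⊥-elim (w∉ (there t))
            ... | inj₁ refl | inj₁ eq        | _       | inj₂ eq′ = L.end-injective i j (trans eq (sym eq′))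
            ... | inj₁ refl | inj₁ eq        | here ex | inj₁ (_ , sy) =
                  ⊥-elim (¬y (subst Side (trans (sym ex) (trans eq sy)) sx))
            ... | inj₁ refl | inj₁ eq        | there t | inj₁ (_ , sy) =
                  ⊥-elim (y∉ (subst (_∈ cut) (trans eq sy) t))

            meet : ∀ i j {w} → w ∈ L.path i ++ R.path (σ i) → w ∈ L.path j ++ R.path (σ j) → i ≡ j
            meet i j p q with ∈-++⁻ (L.path i) p | ∈-++⁻ (L.path j) q
            ... | inj₁ p | inj₁ q = L.disjoint i j _ p q
            ... | inj₁ p | inj₂ q = cross i j p q
            ... | inj₂ p | inj₁ q = sym (cross j i q p)
            ... | inj₂ p | inj₂ q = σ-injective i j (R.disjoint (σ i) (σ j) _ p q)

    -- (x , y) is the only arc from the A-side of the separation to its B-side, so paths from A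
    -- to cut ∪ {x} and from cut ∪ {y} to B, once trimmed, meet only in the cut.
    splice : Side x → y ∉ cut → ¬ Side y →
             Linkage (ArcIn es) A (x ∷ cut) k → Linkage (ArcIn es) (y ∷ cut) B k →
             Linkage E′ A B k
    splice sx y∉ ¬y l r = glue (prefixes l) (suffixes r) sx y∉ ¬y (matching (prefixes l) (suffixes r))

  -- Menger's theorem for vertex sets, by Göring's induction on the number of arcs.
  menger : ∀ es A B k → Linkage (ArcIn es) A B k ⊎ Separation (ArcIn es) A B k
  menger [] A B k = base (k ≤? length C)
    where
      C = filter (_∈? B) (deduplicate _≟_ A)

      A-side : ∀ {u} → u ∈ A → u ∈ C ⊎ (u ∈ A × u ∉ C)
      A-side {u} u∈A with u ∈? C
      ... | yes p = inj₁ p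
      ... | no p = inj₂ (u∈A , p)

      -- Without arcs all walks are single vertices, so the vertices common to `A` and `B` form the
      -- linkage. If they are fewer than `k`, they form the cut, and the rest of `A` is the side.
      base : Dec (k ≤ length C) → Linkage (ArcIn []) A B k ⊎ Separation (ArcIn []) A B k
      base (yes k≤) with pick (Uniqueₚ.filter⁺ (_∈? B) (DecUniqueₚ.deduplicate-! _≟_ A)) k≤
      ... | v , v-injective , v∈C = inj₁ record
        { from = v ; to = v ; path = λ i → v i ∷ [] ; chain = λ i → [ v i ]
        ; from∈ = λ i → ∈-deduplicate⁻ _≟_ A (proj₁ (v∈ i)) ; to∈ = λ i → proj₂ (v∈ i)
        ; disjoint = λ { i j w (here refl) (here eq) → v-injective i j eq } }
        where
          v∈ : ∀ i → v i ∈ deduplicate _≟_ A × v i ∈ B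
          v∈ i = ∈-filter⁻ (_∈? B) {xs = deduplicate _≟_ A} (v∈C i)
      base (no k≰) = inj₂ record
        { Side = λ u → u ∈ A × u ∉ C
        ; side? = λ u → (u ∈? A) ×-dec ¬? (u ∈? C)
        ; cut = C ; small = ≰⇒> k≰ ; side∌cut = proj₂
        ; A-side = A-side
        ; B-side = λ u∈B (u∈A , u∉) → u∉ (∈-filter⁺ (_∈? B) (∈-deduplicate⁺ _≟_ u∈A) u∈B)
        ; closed = λ _ () }
  menger ((x , y) ∷ es) A B k with menger es A B k
  ... | inj₁ l = inj₁ record
    { Linkage l ; chain = λ i → Chain-map there (Linkage.chain l i) }
  ... | inj₂ sep with Separation.side? sep x ×-dec ¬? (y ∈? Separation.cut sep) ×-dec ¬? (Separation.side? sep y)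
  ...   | no nocross = inj₂ (uncut⇒Separation sep nocross)
  ...   | yes (sx , y∉ , ¬y) with menger es A (x ∷ Separation.cut sep) k | menger es (y ∷ Separation.cut sep) B k
  ...     | inj₂ s | _ = inj₂ (leftSeparation sep s)
  ...     | inj₁ _ | inj₂ s = inj₂ (rightSeparation sep s)
  ...     | inj₁ l | inj₁ r = inj₁ (splice sep sx y∉ ¬y l r)

-- Counting in lists, and greedy choice of disjoint paths.

module _ {V : Set} where

  count : {P : V → Set} → Decidable P → List V → ℕ
  count P? xs = length (filter P? xs)

  count-∷ : {P : V → Set} (P? : Decidable P) → ∀ x xs → count P? xs ≤ count P? (x ∷ xs)
  count-∷ P? x xs with P? x
  ... | yes _ = n≤1+n _
  ... | no _ = ≤-refl

  count-⊎ : {P Q R : V → Set} (P? : Decidable P) (Q? : Decidable Q) (R? : Decidable R) →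
            ∀ xs → (∀ {w} → w ∈ xs → P w → Q w ⊎ R w) →
            count P? xs ≤ count Q? xs + count R? xs
  count-⊎ P? Q? R? [] f = z≤n
  count-⊎ P? Q? R? (x ∷ xs) f with count-⊎ P? Q? R? xs (f ∘ there) | P? x | Q? x | R? x
  ... | ih | no _  | no _  | no _  = ih
  ... | ih | no _  | no _  | yes _ = ≤-trans ih (+-monoʳ-≤ _ (n≤1+n _))
  ... | ih | no _  | yes _ | no _  = m≤n⇒m≤1+n ih
  ... | ih | no _  | yes _ | yes _ = m≤n⇒m≤1+n (≤-trans ih (+-monoʳ-≤ _ (n≤1+n _)))
  ... | ih | yes p | no ¬q | no ¬r = ⊥-elim ([ ¬q , ¬r ]′ (f (here refl) p))
  ... | ih | yes _ | no _  | yes _ = ≤-trans (s≤s ih) (≤-reflexive (sym (+-suc _ _)))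
  ... | ih | yes _ | yes _ | no _  = s≤s ih
  ... | ih | yes _ | yes _ | yes _ = s≤s (≤-trans ih (+-monoʳ-≤ _ (n≤1+n _)))

  count-exclusive : {P Q R : V → Set} (P? : Decidable P) (Q? : Decidable Q) (R? : Decidable R) →
            ∀ xs → (∀ {w} → w ∈ xs → Q w → P w) → (∀ {w} → w ∈ xs → R w → P w) →
            (∀ {w} → w ∈ xs → Q w → ¬ R w) → count Q? xs + count R? xs ≤ count P? xs
  count-exclusive P? Q? R? [] f g h = z≤n
  count-exclusive P? Q? R? (x ∷ xs) f g h
    with count-exclusive P? Q? R? xs (f ∘ there) (g ∘ there) (h ∘ there) | P? x | Q? x | R? x
  ... | ih | no _  | no _  | no _  = ih
  ... | ih | yes _ | no _  | no _  = m≤n⇒m≤1+n ih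
  ... | ih | yes _ | yes _ | no _  = s≤s ih
  ... | ih | yes _ | no _  | yes _ = ≤-trans (≤-reflexive (+-suc _ _)) (s≤s ih)
  ... | ih | _     | yes q | yes r = ⊥-elim (h (here refl) q r)
  ... | ih | no ¬p | yes q | _     = ⊥-elim (¬p (f (here refl) q))
  ... | ih | no ¬p | _     | yes r = ⊥-elim (¬p (g (here refl) r))

  filter-count : {P Q : V → Set} (P? : Decidable P) (Q? : Decidable Q) → ∀ xs →
                 count P? (filter Q? xs) ≤ count (λ w → P? w ×-dec Q? w) xs
  filter-count P? Q? [] = z≤n
  filter-count P? Q? (x ∷ xs) with filter-count P? Q? xs | Q? x
  ... | ih | no _ with P? x
  ...   | yes _ = ih
  ...   | no _ = ih
  filter-count P? Q? (x ∷ xs) | ih | yes _ with P? x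
  ...   | yes _ = s≤s ih
  ...   | no _ = ih

  Unique-⊆⇒≤ : {xs ys : List V} → Unique xs → xs ⊆ ys → length xs ≤ length ys
  Unique-⊆⇒≤ {xs} {ys} uxs xs⊆ = Finₚ.injective⇒≤ {f = λ i → Any.index (mem i)}
    λ {i} {j} eq → lookup-injective uxs i j
      (trans (lookup-index (mem i)) (trans (cong (lookup ys) eq) (sym (lookup-index (mem j)))))
    where
      mem : ∀ i → lookup xs i ∈ ys
      mem i = xs⊆ (∈-lookup i)

  -- Order and multiplicity of the vertices are forgotten, so that composing and reversing walks
  -- needs no list equations.
  Within : (V → V → Set) → V → V → List V → Set
  Within E u v vs = ∃ λ us → Chain E u v us × us ⊆ vs

  Within-trans : ∀ {E u v w vs ws} → Within E u v vs → Within E v w ws → Within E u w (vs ++ ws)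
  Within-trans {vs = vs} (us₁ , c₁ , s₁) (us₂ , c₂ , s₂) with c₁ ⁀ c₂
  ... | us , c , s = us , c , λ p → [ ∈-++⁺ˡ ∘ s₁ , ∈-++⁺ʳ vs ∘ s₂ ]′ (∈-++⁻ us₁ (s p))

  Chain-reverse : ∀ {E u v vs} → Chain (flip E) v u vs → Within E u v vs
  Chain-reverse [ x ] = _ , [ x ] , λ p → p
  Chain-reverse {E} {u} {v} {_ ∷ vs} (e ∷ c) with Chain-reverse {E} c
  ... | us , c′ , us⊆ with c′ ⁀ (e ∷ [ v ])
  ...   | ws , d , ws⊆ = ws , d , sub ∘ ws⊆
    where
      sub : us ++ _ ∷ v ∷ [] ⊆ v ∷ vs
      sub p with ∈-++⁻ us p
      ... | inj₁ q = there (us⊆ q)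
      ... | inj₂ (here refl) = there (Chain-head c)
      ... | inj₂ (there (here refl)) = here refl

  -- The lists are chosen one after another, and each is added to the forbidden set. This set grows
  -- by at most 2 entries each time, hence never exceeds `N`.
  greedy : ∀ k {Good : Fin k → List V → Set} {N} F₀ → length F₀ + 2 * k ≤ N →
           (∀ i F → F₀ ⊆ F → length F ≤ N →
              ∃ λ l → length l ≤ 2 × Good i l × (∀ {w} → w ∈ l → w ∉ F)) →
           Σ (Fin k → List V) λ l → (∀ i → Good i (l i)) × (∀ i {w} → w ∈ l i → w ∉ F₀) ×
             Disjoint l × length (concat (tabulate l)) ≤ 2 * k
  greedy zero F₀ _ _ = (λ ()) , (λ ()) , (λ ()) , (λ ()) , z≤n
  greedy (suc k) {Good} {N} F₀ bound find′
    with find′ zero F₀ (λ p → p) (≤-trans (m≤m+n _ _) bound)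
  ... | l₀ , short , good , avoid
    with greedy k {Good ∘ suc} (l₀ ++ F₀) bound′ (λ i F F₀⊆ → find′ (suc i) F (F₀⊆ ∘ ∈-++⁺ʳ l₀))
    where
      bound′ : length (l₀ ++ F₀) + 2 * k ≤ N
      bound′ = begin
        length (l₀ ++ F₀) + 2 * k        ≡⟨ cong (_+ 2 * k) (length-++ l₀) ⟩
        length l₀ + length F₀ + 2 * k    ≤⟨ +-monoˡ-≤ (2 * k) (+-monoˡ-≤ (length F₀) short) ⟩
        2 + length F₀ + 2 * k            ≡⟨ lemma (length F₀) k ⟩
        length F₀ + 2 * suc k            ≤⟨ bound ⟩
        N ∎
        where
          open ≤-Reasoning
          lemma : ∀ f k → 2 + f + 2 * k ≡ f + 2 * suc k
          lemma = solve-∀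
  ... | ls , goods , avoids , disj , total = l , goods′ , avoids′ , disj′ , total′
    where
      l : Fin (suc k) → List V
      l zero = l₀
      l (suc i) = ls i
      goods′ : ∀ i → Good i (l i)
      goods′ zero = good
      goods′ (suc i) = goods i
      avoids′ : ∀ i {w} → w ∈ l i → w ∉ F₀
      avoids′ zero = avoid
      avoids′ (suc i) p q = avoids i p (∈-++⁺ʳ l₀ q)
      disj′ : Disjoint l
      disj′ zero zero w p q = refl
      disj′ zero (suc j) w p q = ⊥-elim (avoids j q (∈-++⁺ˡ p))
      disj′ (suc i) zero w p q = ⊥-elim (avoids i p (∈-++⁺ˡ q))
      disj′ (suc i) (suc j) w p q = cong suc (disj i j w p q)
      total′ : length (l₀ ++ concat (tabulate ls)) ≤ 2 * suc k
      total′ = ≤-trans (≤-reflexive (length-++ l₀))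
        (≤-trans (+-mono-≤ short total) (≤-reflexive (sym (*-suc 2 k))))

-- List difference, and the vertices of largest weight.

module Lists {V : Set} (_≟_ : DecidableEquality V) where

  open DecMembership _≟_ using (_∈?_) public

  infixl 5 _∖_

  _∖_ : List V → List V → List V
  xs ∖ F = filter (λ w → ¬? (w ∈? F)) xs

  ∈-∖⁻ : ∀ {w} xs F → w ∈ xs ∖ F → w ∈ xs × w ∉ F
  ∈-∖⁻ xs F = ∈-filter⁻ (λ w → ¬? (w ∈? F)) {xs = xs}

  ∈-∖⁺ : ∀ {w xs} F → w ∈ xs → w ∉ F → w ∈ xs ∖ F
  ∈-∖⁺ F = ∈-filter⁺ (λ w → ¬? (w ∈? F))

  ∖-unique : ∀ {xs} F → Unique xs → Unique (xs ∖ F)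
  ∖-unique F = Uniqueₚ.filter⁺ (λ w → ¬? (w ∈? F))

  count-∈ : ∀ {xs} F → Unique xs → count (_∈? F) xs ≤ length F
  count-∈ {xs} F uxs = Unique-⊆⇒≤ (Uniqueₚ.filter⁺ (_∈? F) uxs)
    (proj₂ ∘ ∈-filter⁻ (_∈? F) {xs = xs})

  length-∖ : ∀ {xs} F → Unique xs → length xs ≤ length (xs ∖ F) + length F
  length-∖ {xs} F uxs = begin
    length xs                             ≤⟨ lemma xs ⟩
    length (xs ∖ F) + count (_∈? F) xs    ≤⟨ +-monoʳ-≤ _ (count-∈ F uxs) ⟩
    length (xs ∖ F) + length F            ∎
    where
      open ≤-Reasoning
      lemma : ∀ xs → length xs ≤ length (xs ∖ F) + count (_∈? F) xs
      lemma [] = z≤n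
      lemma (x ∷ xs) with x ∈? F | lemma xs
      ... | yes _ | ih = ≤-trans (s≤s ih) (≤-reflexive (sym (+-suc _ _)))
      ... | no _  | ih = s≤s ih

  escape : ∀ {xs} F → Unique xs → length F < length xs → ∃ λ w → w ∈ xs × w ∉ F
  escape {xs} F uxs F< with xs ∖ F in eq | length-∖ {xs} F uxs
  ... | []    | le = contradiction le (<⇒≱ F<)
  ... | w ∷ _ | _  = w , ∈-∖⁻ xs F (subst (w ∈_) (sym eq) (here refl))

  largest : (f : V → ℕ) → ∀ {xs} t → Unique xs → t ≤ length xs →
            ∃ λ I → Unique I × length I ≡ t × I ⊆ xs ×
              (∀ {w v} → w ∈ xs → w ∉ I → v ∈ I → f w ≤ f v)
  largest f zero uxs _ = [] , [] , refl , (λ ()) , λ _ _ ()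
  largest f {xs} (suc t) uxs t< with largest f t uxs (<⇒≤ t<)
  ... | I , uI , refl , I⊆ , top with escape I uxs t<
  ...   | w , w∈ , w∉ = m ∷ I , ¬Any⇒All¬ I (proj₂ m∈) ∷ uI , refl , m∷I⊆ , top′
    where
      m : V
      -- The default `w` comes from `escape`, so `m` is in `xs` and outside `I` even if the default
      -- is returned.
      m = argmax f w (xs ∖ I)
      m∈ : m ∈ xs × m ∉ I
      m∈ with argmax-sel f w (xs ∖ I)
      ... | inj₁ eq = subst (λ v → v ∈ xs × v ∉ I) (sym eq) (w∈ , w∉)
      ... | inj₂ p = ∈-∖⁻ xs I p
      m∷I⊆ : m ∷ I ⊆ xs
      m∷I⊆ (here refl) = proj₁ m∈
      m∷I⊆ (there p) = I⊆ p
      top′ : ∀ {w v} → w ∈ xs → w ∉ m ∷ I → v ∈ m ∷ I → f w ≤ f v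
      top′ w∈ w∉ (here refl) = All.lookup (f[xs]≤f[argmax] {f = f} w (xs ∖ I)) (∈-∖⁺ I w∈ (w∉ ∘ there))
      top′ w∈ w∉ (there p) = top w∈ (w∉ ∘ there) p

-- Degrees and short paths in semicomplete digraphs.

module Semicomplete {V : Set} (_≟_ : DecidableEquality V) {E : V → V → Set} (E? : B.Decidable E)
  (total : ∀ {u v} → u ≢ v → E u v ⊎ E v u) where

  open Lists _≟_

  deg⁺ deg⁻ : List V → V → ℕ
  deg⁺ xs u = count (E? u) xs
  deg⁻ xs v = count (λ w → E? w v) xs

  private
    Σdeg : List V → List V → ℕ
    Σdeg xs ys = sum (map (deg⁻ xs) ys)

    exchange : ∀ a b c → a + (b + c) ≡ b + (a + c)
    exchange = solve-∀

    -- Double counting: a new source `x` contributes one for each arc from `x` into `ys`.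
    Σdeg-∷ : ∀ x xs ys → Σdeg (x ∷ xs) ys ≡ deg⁺ ys x + Σdeg xs ys
    Σdeg-∷ x xs [] = refl
    Σdeg-∷ x xs (y ∷ ys) with E? x y
    ... | yes _ = cong suc (trans (cong (deg⁻ xs y +_) (Σdeg-∷ x xs ys)) (exchange (deg⁻ xs y) (deg⁺ ys x) _))
    ... | no _  = trans (cong (deg⁻ xs y +_) (Σdeg-∷ x xs ys)) (exchange (deg⁻ xs y) (deg⁺ ys x) _)

    length≤deg : ∀ {x xs} → All (x ≢_) xs → length xs ≤ deg⁻ xs x + deg⁺ xs x
    length≤deg [] = z≤n
    length≤deg {x} {y ∷ _} (x≢y ∷ x≢) with length≤deg x≢ | E? y x | E? x y
    ... | ih | yes _ | yes _ = s≤s (≤-trans ih (+-monoʳ-≤ _ (n≤1+n _)))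
    ... | ih | yes _ | no _  = s≤s ih
    ... | ih | no _  | yes _ = ≤-trans (s≤s ih) (≤-reflexive (sym (+-suc _ _)))
    ... | _  | no p  | no q  = ⊥-elim ([ q , p ]′ (total x≢y))

    -- For m vertices this is m(m - 1) ≤ 2 · (number of arcs), without subtraction; each new vertex
    -- is joined to all the others by at least one arc.
    Σdeg-lower : ∀ {xs} → Unique xs → length xs * length xs ≤ 2 * Σdeg xs xs + length xs
    Σdeg-lower [] = z≤n
    Σdeg-lower {x ∷ xs} (x≢ ∷ u) = begin
      suc l * suc l                                    ≡⟨ square l ⟩
      l * l + l + suc l                                ≤⟨ +-monoˡ-≤ (suc l) (+-monoˡ-≤ l (Σdeg-lower u)) ⟩
      2 * s + l + l + suc l                            ≡⟨ twice s l ⟩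
      2 * (l + s) + suc l                              ≤⟨ +-monoˡ-≤ (suc l) (*-monoʳ-≤ 2 (+-monoˡ-≤ s (length≤deg x≢))) ⟩
      2 * (deg⁻ xs x + deg⁺ xs x + s) + suc l          ≡⟨ cong (λ t → 2 * t + suc l) (+-assoc (deg⁻ xs x) _ _) ⟩
      2 * (deg⁻ xs x + (deg⁺ xs x + s)) + suc l        ≡⟨ cong (λ t → 2 * (deg⁻ xs x + t) + suc l) (sym (Σdeg-∷ x xs xs)) ⟩
      2 * (deg⁻ xs x + Σdeg (x ∷ xs) xs) + suc l       ≤⟨ +-monoˡ-≤ (suc l) (*-monoʳ-≤ 2 (+-monoˡ-≤ _ (count-∷ (λ w → E? w x) x xs))) ⟩
      2 * Σdeg (x ∷ xs) (x ∷ xs) + suc l               ∎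
      where
        open ≤-Reasoning
        l = length xs
        s = Σdeg xs xs
        square : ∀ l → suc l * suc l ≡ l * l + l + suc l
        square = solve-∀
        twice : ∀ s l → 2 * s + l + l + suc l ≡ 2 * (l + s) + suc l
        twice = solve-∀

    sum-upper : ∀ (f : V → ℕ) m xs → All (λ x → 2 * f x + 2 ≤ m) xs →
                2 * sum (map f xs) + 2 * length xs ≤ m * length xs
    sum-upper f m [] [] = z≤n
    sum-upper f m (x ∷ xs) (p ∷ ps) = begin
      2 * (f x + s) + 2 * suc l         ≡⟨ split (f x) s l ⟩
      2 * f x + 2 + (2 * s + 2 * l)     ≤⟨ +-mono-≤ p (sum-upper f m xs ps) ⟩
      m + m * l                         ≡⟨ sym (*-suc m l) ⟩
      m * suc l                         ∎
      where
        open ≤-Reasoning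
        l = length xs
        s = sum (map f xs)
        split : ∀ a s l → 2 * (a + s) + 2 * suc l ≡ 2 * a + 2 + (2 * s + 2 * l)
        split = solve-∀

  deg⁻-average : ∀ {xs} → Unique xs → 0 < length xs →
                 ∃ λ p → p ∈ xs × length xs ≤ 2 * deg⁻ xs p + 1
  deg⁻-average {xs} uxs nonempty with Any.any? (λ p → length xs ≤? 2 * deg⁻ xs p + 1) xs
  ... | yes found = find found
  -- If all in-degrees were below (l - 1)/2, then `2 * s + 2 * l ≤ l * l ≤ 2 * s + l`, which forces
  -- `l` to be 0.
  ... | no none = contradiction (+-cancelˡ-≤ (2 * s + l) l 0 (begin
      2 * s + l + l       ≡⟨ double s l ⟩
      2 * s + 2 * l       ≤⟨ sum-upper (deg⁻ xs) l xs (All.map big (¬Any⇒All¬ xs none)) ⟩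
      l * l               ≤⟨ Σdeg-lower uxs ⟩
      2 * s + l           ≡⟨ sym (+-identityʳ _) ⟩
      2 * s + l + 0       ∎)) (<⇒≱ nonempty)
    where
      open ≤-Reasoning
      l = length xs
      s = Σdeg xs xs
      double : ∀ s l → 2 * s + l + l ≡ 2 * s + 2 * l
      double = solve-∀
      big : ∀ {p} → ¬ l ≤ 2 * deg⁻ xs p + 1 → 2 * deg⁻ xs p + 2 ≤ l
      big {p} ≰ = ≤-trans (≤-reflexive (+-suc (2 * deg⁻ xs p) 1)) (≰⇒> ≰)

  -- Averaging inside the set of low vertices, of size s, gives one with in-degree at least (s -
  -- 1)/2, while its in-degree in all of `L` is below `θ`.
  few-low-degree : ∀ {L} → Unique L → ∀ θ → length (filter (λ v → deg⁻ L v <? θ) L) ≤ 2 * θ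
  few-low-degree {L} uL θ with filter low? L in eq
    where
      low? : ∀ v → Dec (deg⁻ L v < θ)
      low? v = deg⁻ L v <? θ
  ... | [] = z≤n
  ... | w ∷ ws with deg⁻-average (subst Unique eq (Uniqueₚ.filter⁺ _ uL)) (s≤s z≤n)
  ...   | p , p∈ , avg with ∈-filter⁻ (λ v → deg⁻ L v <? θ) {xs = L} (subst (p ∈_) (sym eq) p∈)
  ...     | _ , low = begin
    suc (length ws)                    ≤⟨ avg ⟩
    2 * deg⁻ (w ∷ ws) p + 1            ≤⟨ +-monoˡ-≤ 1 (*-monoʳ-≤ 2 (Unique-⊆⇒≤
                                            (Uniqueₚ.filter⁺ (λ v → E? v p) (subst Unique eq (Uniqueₚ.filter⁺ _ uL))) sub)) ⟩
    2 * deg⁻ L p + 1                   ≤⟨ +-monoʳ-≤ (2 * deg⁻ L p) (s≤s z≤n) ⟩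
    2 * deg⁻ L p + 2                   ≡⟨ two (deg⁻ L p) ⟩
    2 * suc (deg⁻ L p)                 ≤⟨ *-monoʳ-≤ 2 low ⟩
    2 * θ                              ∎
    where
      open ≤-Reasoning
      two : ∀ d → 2 * d + 2 ≡ 2 * suc d
      two = solve-∀
      sub : filter (λ v → E? v p) (w ∷ ws) ⊆ filter (λ v → E? v p) L
      sub q with ∈-filter⁻ (λ v → E? v p) {xs = w ∷ ws} q
      ... | q∈ , e = ∈-filter⁺ (λ v → E? v p)
        (proj₁ (∈-filter⁻ (λ v → deg⁻ L v <? θ) {xs = L} (subst (_ ∈_) (sym eq) q∈))) e

  -- Let p have at least average in-degree among the out-neighbours of u outside F and I. If all
  -- in-neighbours of v outside F sent arcs to p rather than receiving one from p, the in-degree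
  -- of p would exceed that of v.
  shortPath : ∀ {L} I F {u v} → Unique L → u ∈ F → v ∈ F →
              (∀ {w} → w ∈ L → w ∉ I → deg⁻ L w ≤ deg⁻ L v) →
              3 * length F + length I + 2 ≤ deg⁺ L u →
              ∃ λ l → length l ≤ 2 × Within E u v (u ∷ v ∷ l) × (∀ {w} → w ∈ l → w ∈ L × w ∉ F)
  shortPath {L} I F {u} {v} uL u∈F v∈F top big with Any.any? (λ w → ¬? (w ∈? F) ×-dec E? u w ×-dec E? w v) L
  ... | yes found with find found
  ...   | w , w∈L , w∉F , uw , wv =
          w ∷ [] , s≤s z≤n , (_ , uw ∷ wv ∷ [ v ] ,
            λ { (here refl) → here refl ; (there (here refl)) → there (there (here refl))
              ; (there (there (here refl))) → there (here refl) }) ,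
          λ { (here refl) → w∈L , w∉F }
  shortPath {L} I F {u} {v} uL u∈F v∈F top big | no none =
    extend (deg⁻-average uP′ (≤-trans (m≤n+m 1 _) (≤-trans (≤-reflexive (+-assoc (2 * length F) 1 1)) P′-large)))
    where
      P? : ∀ w → Dec ((w ∉ F × w ∉ I) × E u w)
      P? w = (¬? (w ∈? F) ×-dec ¬? (w ∈? I)) ×-dec E? u w
      P′ = filter P? L
      uP′ : Unique P′
      uP′ = Uniqueₚ.filter⁺ P? uL

      -- Of at least `3 * f + i + 2` out-neighbours, at most `f` are lost to `F` and at most `i` to
      -- `I`.
      P′-large : 2 * length F + 2 ≤ length P′
      P′-large = +-cancelʳ-≤ (length F + length I) _ _ (begin
        2 * f + 2 + (f + i)                     ≡⟨ arrange f i ⟩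
        3 * f + i + 2                           ≤⟨ big ⟩
        deg⁺ L u                                ≤⟨ count-⊎ (E? u) P? out? L cover ⟩
        length P′ + count out? L                ≤⟨ +-monoʳ-≤ (length P′) (count-⊎ out? (_∈? F) (_∈? I) L (λ _ p → p)) ⟩
        length P′ + (count (_∈? F) L + count (_∈? I) L)
                                                ≤⟨ +-monoʳ-≤ (length P′) (+-mono-≤ (count-∈ F uL) (count-∈ I uL)) ⟩
        length P′ + (f + i)                     ∎)
        where
          open ≤-Reasoning
          f = length F
          i = length I
          out? : ∀ w → Dec (w ∈ F ⊎ w ∈ I)
          out? w = (w ∈? F) ⊎-dec (w ∈? I)
          cover : ∀ {w} → w ∈ L → E u w → ((w ∉ F × w ∉ I) × E u w) ⊎ (w ∈ F ⊎ w ∈ I)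
          cover {w} _ uw with w ∈? F | w ∈? I
          ... | yes p | _ = inj₂ (inj₁ p)
          ... | no _ | yes p = inj₂ (inj₂ p)
          ... | no p | no q = inj₁ ((p , q) , uw)
          arrange : ∀ f i → 2 * f + 2 + (f + i) ≡ 3 * f + i + 2
          arrange = solve-∀

      extend : (∃ λ p → p ∈ P′ × length P′ ≤ 2 * deg⁻ P′ p + 1) → _
      extend (p , p∈ , avg) with ∈-filter⁻ P? {xs = L} p∈
      ... | p∈L , (p∉F , p∉I) , up with Any.any? (λ w → ¬? (w ∈? F) ×-dec E? p w ×-dec E? w v) L
      ...   | yes found with find found
      ...     | w , w∈L , w∉F , pw , wv =
                p ∷ w ∷ [] , s≤s (s≤s z≤n) , (_ , up ∷ pw ∷ wv ∷ [ v ] ,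
                  λ { (here refl) → here refl ; (there (here refl)) → there (there (here refl))
                    ; (there (there (here refl))) → there (there (there (here refl)))
                    ; (there (there (there (here refl)))) → there (here refl) }) ,
                λ { (here refl) → p∈L , p∉F ; (there (here refl)) → w∈L , w∉F ; (there (there ())) }
      extend (p , p∈ , avg) | p∈L , (p∉F , p∉I) , up | no none′ =
        contradiction (+-cancelˡ-≤ (2 * length F) 2 1 (begin
          2 * length F + 2         ≤⟨ P′-large ⟩
          length P′                ≤⟨ avg ⟩
          2 * deg⁻ P′ p + 1        ≤⟨ +-monoˡ-≤ 1 (*-monoʳ-≤ 2 few) ⟩
          2 * length F + 1         ∎)) λ { (s≤s ()) }
        where
          open ≤-Reasoning
          Q? : ∀ w → Dec (w ∉ F × E w v)
          Q? w = ¬? (w ∈? F) ×-dec E? w v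
          -- If `w` were `p`, then `p` alone would link `u` to `v`; an arc from `p` to `w` would
          -- give a path with inner vertices `p` and `w`. Both were ruled out.
          Q→p : ∀ {w} → w ∈ L → w ∉ F × E w v → E w p
          Q→p {w} w∈L (w∉F , wv) with w ≟ p
          ... | yes refl = ⊥-elim (none (lose w∈L (w∉F , up , wv)))
          ... | no w≢p with total w≢p
          ...   | inj₁ wp = wp
          ...   | inj₂ pw = ⊥-elim (none′ (lose w∈L (w∉F , pw , wv)))
          -- The in-neighbours of `v` outside `F` are disjoint from `P′`, or one inner vertex would
          -- do. They and the in-neighbours of `p` in `P′` all count towards the in-degree of `p`,
          -- which is at most that of `v` as `p` is not in `I`.
          few : deg⁻ P′ p ≤ length F
          few = +-cancelˡ-≤ (count Q? L) _ _ (begin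
            count Q? L + deg⁻ P′ p     ≤⟨ +-monoʳ-≤ (count Q? L) (filter-count (λ w → E? w p) P? L) ⟩
            count Q? L + count (λ w → E? w p ×-dec P? w) L
                                       ≤⟨ count-exclusive (λ w → E? w p) Q? (λ w → E? w p ×-dec P? w) L
                                            Q→p (λ _ → proj₁) (λ w∈ (w∉ , wv) (_ , (_ , uw)) → none (lose w∈ (w∉ , uw , wv))) ⟩
            deg⁻ L p                   ≤⟨ top p∈L p∉I ⟩
            deg⁻ L v                   ≤⟨ count-⊎ (λ w → E? w v) Q? (_∈? F) L cover ⟩
            count Q? L + count (_∈? F) L  ≤⟨ +-monoʳ-≤ (count Q? L) (count-∈ F uL) ⟩
            count Q? L + length F      ∎)
            where
              cover : ∀ {w} → w ∈ L → E w v → (w ∉ F × E w v) ⊎ w ∈ F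
              cover {w} _ wv with w ∈? F
              ... | yes q = inj₂ q
              ... | no q = inj₁ (q , wv)

-- Connectivity, minimum degree and disjoint families of lists.

Connected : {V : Set} → (V → V → Set) → ℕ → Set
Connected {V} E m = ∀ (S : List V) {u v} → length S < m → u ∉ S → v ∉ S →
                    ∃ λ vs → Chain E u v vs × (∀ {w} → w ∈ vs → w ∉ S)

module _ {V : Set} where

  Connected-flip : ∀ {E : V → V → Set} {m} → Connected E m → Connected (flip E) m
  Connected-flip {E} conn S S< u∉ v∉ with conn S S< v∉ u∉
  ... | vs , c , avoid with Chain-reverse {E = flip E} c
  ...   | us , d , us⊆ = us , d , avoid ∘ us⊆

  Chain-preserves : ∀ {E : V → V → Set} {P : V → Set} {u v vs} → Chain E u v vs → P u →
                    (∀ {a b} → b ∈ vs → P a → E a b → P b) → ∀ {w} → w ∈ vs → P w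
  Chain-preserves [ _ ] pu pres (here refl) = pu
  Chain-preserves (e ∷ c) pu pres (here refl) = pu
  Chain-preserves (e ∷ c) pu pres (there p) =
    Chain-preserves c (pres (there (Chain-head c)) pu e) (pres ∘ there) p

  -- If `u` had fewer than `m` out-neighbours, deleting them would leave `u` and some further vertex
  -- `w`; but every walk from `u` to `w` enters a deleted vertex at its first step.
  minimum-degree : ∀ {E : V → V → Set} (E? : B.Decidable E) → (∀ {u} → ¬ E u u) →
                   ∀ {all m} → Unique all → (∀ v → v ∈ all) → m < length all → Connected E m →
                   DecidableEquality V → ∀ u → m ≤ count (E? u) all
  minimum-degree {E} E? irrefl {all} {m} uall complete m< conn _≟_ u with m ≤? count (E? u) all
  ... | yes le = le
  ... | no nle with Lists.escape _≟_ (u ∷ filter (E? u) all) uall (≤-trans (s≤s (≰⇒> nle)) m<)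
  ...   | w , _ , w∉ = stuck (conn S (≰⇒> nle) (irrefl ∘ proj₂ ∘ ∈-filter⁻ (E? u) {xs = all}) (w∉ ∘ there))
    where
      S = filter (E? u) all
      stuck : (∃ λ vs → Chain E u w vs × (∀ {w} → w ∈ vs → w ∉ S)) → m ≤ count (E? u) all
      stuck (_ , [ _ ] , _) = contradiction (here refl) w∉
      stuck (_ , e ∷ c , avoid) = contradiction (∈-filter⁺ (E? u) (complete _) e) (avoid (there (Chain-head c)))

  Apart : ∀ {I : Set} → (I → List V) → (I → List V) → Set
  Apart P Q = ∀ i j {w} → w ∈ P i → w ∉ Q j

  Disjoint-++ : ∀ {I : Set} {P Q : I → List V} → Disjoint P → Disjoint Q → Apart P Q →
                Disjoint (λ i → P i ++ Q i)
  Disjoint-++ {P = P} dP dQ apart i j w p q with ∈-++⁻ (P i) p | ∈-++⁻ (P j) q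
  ... | inj₁ p | inj₁ q = dP i j w p q
  ... | inj₁ p | inj₂ q = ⊥-elim (apart i j p q)
  ... | inj₂ p | inj₁ q = ⊥-elim (apart j i q p)
  ... | inj₂ p | inj₂ q = dQ i j w p q

  Apart-++ : ∀ {I : Set} {P Q R : I → List V} → Apart P R → Apart Q R → Apart (λ i → P i ++ Q i) R
  Apart-++ {P = P} aP aQ i j p = [ aP i j , aQ i j ]′ (∈-++⁻ (P i) p)

  Disjoint-singleton : ∀ {I : Set} {f : I → V} → (∀ i j → f i ≡ f j → i ≡ j) → Disjoint (λ i → f i ∷ [])
  Disjoint-singleton inj i j w (here eq) (here eq′) = inj i j (trans (sym eq) eq′)

  ∈-concat-tabulate : ∀ {k} (P : Fin k → List V) i → P i ⊆ concat (tabulate P)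
  ∈-concat-tabulate P i p = ∈-concat⁺′ p (∈-tabulate⁺ i)

  concat-tabulate⁻ : ∀ {k} (P : Fin k → List V) {w} → w ∈ concat (tabulate P) → ∃ λ i → w ∈ P i
  concat-tabulate⁻ P p with ∈-concat⁻′ (tabulate P) p
  ... | _ , q , r with ∈-tabulate⁻ r
  ...   | i , refl = i , q

-- Linking in highly connected semicomplete digraphs.

module Linking {V : Set} (_≟_ : DecidableEquality V) {E : V → V → Set} (E? : B.Decidable E)
  (irrefl : ∀ {u} → ¬ E u u) (total : ∀ {u v} → u ≢ v → E u v ⊎ E v u)
  (all : List V) (complete : ∀ v → v ∈ all) (uall : Unique all)
  (k : ℕ) (1≤k : 1 ≤ k) (order : 200 * k < length all) (conn : Connected E (200 * k)) where

  open Lists _≟_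
  open Semicomplete _≟_ E? total
  -- In the reversed digraph `Op.deg⁻` is `deg⁺`, so each result on in-degrees also yields its dual.
  private module Op = Semicomplete _≟_ {flip E} (flip E?) (swap ∘ total)
  open Menger _≟_

  private
    -- Abstract, because conversion checking is infeasible once products by large numerals unfold.
    abstract
      _·k : ℕ → ℕ
      a ·k = a * k

      ·k≡ : ∀ a → a ·k ≡ a * k
      ·k≡ a = refl

    infixl 8 _·k

    lit : ∀ a b {_ : T (a ≤ᵇ b)} → a ·k ≤ b ·k
    lit a b {le} rewrite ·k≡ a | ·k≡ b = *-monoˡ-≤ k (≤ᵇ⇒≤ a b le)

    ·k-+ : ∀ a b → a ·k + b ·k ≡ (a + b) ·k
    ·k-+ a b rewrite ·k≡ a | ·k≡ b | ·k≡ (a + b) = sym (*-distribʳ-+ k a b)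

    k≡1·k : k ≡ 1 ·k
    k≡1·k = trans (sym (*-identityˡ k)) (sym (·k≡ 1))

    plus : ∀ {m n} a b → m ≤ a ·k → n ≤ b ·k → m + n ≤ (a + b) ·k
    plus a b p q = ≤-trans (+-mono-≤ p q) (≤-reflexive (·k-+ a b))

    ++-size : ∀ (xs ys : List V) a b → length xs ≤ a ·k → length ys ≤ b ·k →
              length (xs ++ ys) ≤ (a + b) ·k
    ++-size xs ys a b p q = ≤-trans (≤-reflexive (length-++ xs)) (plus a b p q)

    tabulate-size : (f : Fin k → V) → length (tabulate f) ≤ 1 ·k
    tabulate-size f = ≤-reflexive (trans (length-tabulate f) k≡1·k)

    -- Bounds the degree that `shortPath` demands by a multiple of `k`; the summand 2 becomes `2 ·k`
    -- since `1 ≤ k`.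
    budget : ∀ {f i} a b → f ≤ a ·k → i ≤ b ·k → 3 * f + i + 2 ≤ (3 * a + b + 2) ·k
    budget {f} {i} a b f≤ i≤ = plus (3 * a + b) 2 (plus (3 * a) b 3f≤ i≤) 2≤
      where
        3f≤ : 3 * f ≤ (3 * a) ·k
        3f≤ rewrite ·k≡ (3 * a) | *-assoc 3 a k | sym (·k≡ a) = *-monoʳ-≤ 3 f≤
        2≤ : 2 ≤ 2 ·k
        2≤ rewrite ·k≡ 2 = *-monoʳ-≤ 2 1≤k

    remaining : ∀ {n m} a b → (a + b) ·k ≤ n + m → m ≤ b ·k → a ·k ≤ n
    remaining {n} {m} a b le m≤ = +-cancelʳ-≤ (b ·k) (a ·k) n
      (≤-trans (≤-reflexive (·k-+ a b)) (≤-trans le (+-monoʳ-≤ n m≤)))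

    order′ : 200 ·k < length all
    order′ = subst (_< length all) (sym (·k≡ 200)) order

    conn′ : Connected E (200 ·k)
    conn′ = subst (Connected E) (sym (·k≡ 200)) conn

    all-size : ∀ a {_ : T (a ≤ᵇ 200)} → a ·k ≤ length all
    all-size a {le} = ≤-trans (lit a 200 {le}) (<⇒≤ order′)

  degree⁺ : ∀ u → 200 ·k ≤ deg⁺ all u
  degree⁺ = minimum-degree E? irrefl uall complete order′ conn′ _≟_

  degree⁻ : ∀ u → 200 ·k ≤ deg⁻ all u
  degree⁻ = minimum-degree (flip E?) irrefl uall complete order′ (Connected-flip {E = E} conn′) _≟_

  few-low-outdegree : ∀ {L} → Unique L → ∀ θ → length (filter (λ u → deg⁺ L u <? θ) L) ≤ 2 * θ
  few-low-outdegree uL θ = Op.few-low-degree uL θ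

  -- The degree `15 ·k` is what `linker` spends: 15 = 3 · 4 + 1 + 2, for at most `4 ·k` forbidden
  -- vertices and the `k` vertices of `Y`. `I-top` concerns the whole digraph and serves the paths
  -- into `X`; `Y-top` concerns `L` and serves paths that stay inside it.
  record Hub (Z : List V) : Set where
    field
      I L Y    : List V
      X        : Fin k → V
      I-size   : length I ≤ 34 ·k
      I-top    : ∀ {w v} → w ∉ I → v ∈ I → deg⁻ all w ≤ deg⁻ all v
      L⊆I      : L ⊆ I
      L∌Z      : ∀ {w} → w ∈ L → w ∉ Z
      L-size   : length L ≤ 34 ·k
      L-unique : Unique L
      Y⊆L      : Y ⊆ L
      Y-unique : Unique Y
      Y-size   : length Y ≡ k
      Y-top    : ∀ {w v} → w ∈ L → w ∉ Y → v ∈ Y → deg⁻ L w ≤ deg⁻ L v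
      X-inj    : ∀ i j → X i ≡ X j → i ≡ j
      X∈L      : ∀ i → X i ∈ L
      X∉Y      : ∀ i → X i ∉ Y
      X-degree : ∀ i → 15 ·k ≤ deg⁺ L (X i)

  hub : ∀ Z → length Z ≤ 2 ·k → Hub Z
  hub Z Z≤ = withI (largest (deg⁻ all) (34 ·k) uall (all-size 34))
    where
      withI : (∃ λ I → Unique I × length I ≡ 34 ·k × I ⊆ all ×
                (∀ {w v} → w ∈ all → w ∉ I → v ∈ I → deg⁻ all w ≤ deg⁻ all v)) → Hub Z
      withI (I , uI , I-size , _ , I-top) = withY (largest (deg⁻ L) k uL
          (≤-trans (≤-reflexive k≡1·k) (≤-trans (lit 1 32) L-large)))
        where
          L = I ∖ Z
          uL = ∖-unique Z uI
          -- Of `34 ·k` vertices at most `2 ·k` are in `Z`. Of the other `32 ·k`, at most `30 ·k`,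
          -- twice `15 ·k`, have low out-degree, and `k` are in `Y`, so at least `k` are left for
          -- `X`.
          L-large : 32 ·k ≤ length L
          L-large = remaining 32 2 (≤-trans (≤-reflexive (sym I-size)) (length-∖ Z uI)) Z≤
          low? : ∀ w → Dec (deg⁺ L w < 15 ·k)
          low? w = deg⁺ L w <? 15 ·k
          Low = filter low? L
          few-low : length Low ≤ 30 ·k
          few-low = ≤-trans (few-low-outdegree uL (15 ·k)) (≤-reflexive
            (trans (cong (15 ·k +_) (+-identityʳ (15 ·k))) (·k-+ 15 15)))
          many-high : 2 ·k ≤ length (L ∖ Low)
          many-high = remaining 2 30 (≤-trans L-large (length-∖ Low uL)) few-low

          withY : (∃ λ Y → Unique Y × length Y ≡ k × Y ⊆ L ×
                    (∀ {w v} → w ∈ L → w ∉ Y → v ∈ Y → deg⁻ L w ≤ deg⁻ L v)) → Hub Z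
          withY (Y , uY , Y-size , Y⊆ , Y-top) = withX (pick (∖-unique Y (∖-unique Low uL))
              (≤-trans (≤-reflexive k≡1·k) (remaining 1 1 (≤-trans many-high (length-∖ Y (∖-unique Low uL)))
                (≤-reflexive (trans Y-size k≡1·k)))))
            where
              withX : (Σ (Fin k → V) λ f → (∀ i j → f i ≡ f j → i ≡ j) × (∀ i → f i ∈ (L ∖ Low) ∖ Y)) → Hub Z
              withX (X , X-inj , X∈) = record
                { I = I ; L = L ; Y = Y ; X = X
                ; I-size = ≤-reflexive I-size
                ; I-top = I-top (complete _)
                ; L⊆I = proj₁ ∘ ∈-∖⁻ I Z
                ; L∌Z = proj₂ ∘ ∈-∖⁻ I Z
                ; L-size = ≤-trans (length-filter _ I) (≤-reflexive I-size)
                ; L-unique = uL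
                ; Y⊆L = Y⊆ ; Y-unique = uY ; Y-size = Y-size ; Y-top = Y-top
                ; X-inj = X-inj
                ; X∈L = λ i → proj₁ (high i)
                ; X∉Y = λ i → proj₂ (∈-∖⁻ (L ∖ Low) Y (X∈ i))
                ; X-degree = λ i → ≮⇒≥ λ low → proj₂ (high i) (∈-filter⁺ low? (proj₁ (high i)) low) }
                where
                  high : ∀ i → X i ∈ L × X i ∉ Low
                  high i = ∈-∖⁻ L Low (proj₁ (∈-∖⁻ (L ∖ Low) Y (X∈ i)))

  module _ {Z : List V} (h : Hub Z) where

    open Hub h

    -- `Y′` is arbitrary, so every order in which the crossing paths may leave `Y` can be served.
    -- Degrees are taken in `L` to keep the inner vertices in `L`.
    linker : (Y′ : Fin k → V) → (∀ i → Y′ i ∈ Y) →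
             Σ (Fin k → List V) λ c → (∀ i → Within E (X i) (Y′ i) (X i ∷ Y′ i ∷ c i)) ×
               (∀ i {w} → w ∈ c i → w ∈ L × w ∉ tabulate X ++ Y) × Disjoint c
    -- The bound `4 ·k` allows `2 ·k` for `X` and `Y` and 2 inner vertices for each of the `k`
    -- paths.
    linker Y′ Y′∈ with greedy k {Good = λ i l → Within E (X i) (Y′ i) (X i ∷ Y′ i ∷ l) × l ⊆ L} {N = 4 ·k} F₀
        (plus 2 2 F₀-size (≤-reflexive (sym (·k≡ 2)))) search
      where
        F₀ = tabulate X ++ Y
        F₀-size : length F₀ ≤ 2 ·k
        F₀-size = ++-size (tabulate X) Y 1 1 (tabulate-size X) (≤-reflexive (trans Y-size k≡1·k))
        search : ∀ i F → F₀ ⊆ F → length F ≤ 4 ·k →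
                 ∃ λ l → length l ≤ 2 × (Within E (X i) (Y′ i) (X i ∷ Y′ i ∷ l) × l ⊆ L) × (∀ {w} → w ∈ l → w ∉ F)
        search i F F₀⊆ F≤ with shortPath Y F L-unique (F₀⊆ (∈-++⁺ˡ (∈-tabulate⁺ i)))
            (F₀⊆ (∈-++⁺ʳ (tabulate X) (Y′∈ i))) (λ w∈ w∉ → Y-top w∈ w∉ (Y′∈ i))
            (≤-trans (budget 4 1 F≤ (≤-reflexive (trans Y-size k≡1·k))) (X-degree i))
        ... | l , short , path , inside = l , short , (path , proj₁ ∘ inside) , proj₂ ∘ inside
    ... | c , good , avoid , disjoint , _ = c , proj₁ ∘ good , (λ i p → proj₂ (good i) p , avoid i p) , disjoint

  record Exits (F : List V) : Set where
    field
      O      : List V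
      o      : Fin k → V
      O-size : length O ≤ 37 ·k
      O-top  : ∀ {w v} → w ∉ O → v ∈ O → deg⁺ all w ≤ deg⁺ all v
      o-inj  : ∀ i j → o i ≡ o j → i ≡ j
      o∈O    : ∀ i → o i ∈ O
      o∉F    : ∀ i → o i ∉ F

  -- As 37 = 36 + 1, at least `k` of the `37 ·k` vertices of largest out-degree lie outside `F`.
  exits : ∀ F → length F ≤ 36 ·k → Exits F
  exits F F≤ with largest (deg⁺ all) (37 ·k) uall (all-size 37)
  ... | O , uO , O-size , _ , top with pick {k = k} (∖-unique F uO) (≤-trans (≤-reflexive k≡1·k)
        (remaining 1 36 (≤-trans (≤-reflexive (sym O-size)) (length-∖ F uO)) F≤))
  ...   | o , o-inj , o∈ = record
    { O = O ; o = o ; O-size = ≤-reflexive O-size ; O-top = top (complete _) ; o-inj = o-inj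
    ; o∈O = λ i → proj₁ (∈-∖⁻ O F (o∈ i)) ; o∉F = λ i → proj₂ (∈-∖⁻ O F (o∈ i)) }

  record Crossing (Y : List V) (o : Fin k → V) (F : List V) : Set where
    field
      from     : Fin k → V
      path     : Fin k → List V
      from∈    : ∀ i → from i ∈ Y
      chain    : ∀ i → Chain E (from i) (o i) (path i)
      avoids   : ∀ i {w} → w ∈ path i → w ∉ F
      disjoint : Disjoint path

  -- Menger's theorem is applied to the arcs that avoid `F`. A separator of fewer than `k` vertices
  -- would, together with `F`, be a set of fewer than `41 ·k` vertices that contradicts `conn′`.
  crossing : ∀ (Y : List V) (o : Fin k → V) F → Unique Y → length Y ≡ k → (∀ i j → o i ≡ o j → i ≡ j) →
             length F ≤ 40 ·k → (∀ {w} → w ∈ Y → w ∉ F) → (∀ i → o i ∉ F) →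
             Crossing Y o F
  crossing Y o F uY Y-size o-inj F≤ Y∌F o∌F = conclude (menger arcs Y (tabulate o) k)
    where
      Free : V × V → Set
      Free (u , v) = E u v × u ∉ F × v ∉ F
      free? : Decidable Free
      free? (u , v) = E? u v ×-dec ¬? (u ∈? F) ×-dec ¬? (v ∈? F)
      arcs = filter free? (cartesianProduct all all)
      free : ∀ {u v} → ArcIn arcs u v → Free (u , v)
      free p = proj₂ (∈-filter⁻ free? {xs = cartesianProduct all all} p)

      -- `Y` and the `o i` are `k` vertices each, so each set has a vertex outside the cut. A walk
      -- between these two that avoids the cut and `F` could never leave the side.
      separated : ¬ Separation (ArcIn arcs) Y (tabulate o) k
      separated sep with escape (Separation.cut sep) uY (≤-trans (Separation.small sep) (≤-reflexive (sym Y-size)))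
        | escape (Separation.cut sep) (Uniqueₚ.tabulate⁺ {f = o} (o-inj _ _))
            (≤-trans (Separation.small sep) (≤-reflexive (sym (length-tabulate o))))
      ... | a , a∈ , a∉ | b , b∈ , b∉ = B-side b∈ (proj₁
          (Chain-preserves {P = λ v → Side v × v ∉ F} c (start (A-side a∈)) stays (Chain-last c)))
        where
          open Separation sep
          b∌F : b ∉ F
          b∌F with ∈-tabulate⁻ b∈
          ... | i , refl = o∌F i
          out : ∀ {v} → v ∉ cut → v ∉ F → v ∉ cut ++ F
          out p q = [ p , q ]′ ∘ ∈-++⁻ cut
          route = conn′ (cut ++ F) (≤-trans (s≤s (≤-reflexive (length-++ cut)))
                    (≤-trans (+-mono-≤ (≤-trans small (≤-reflexive k≡1·k)) F≤)
                      (≤-trans (≤-reflexive (·k-+ 1 40)) (lit 41 200))))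
                    (out a∉ (Y∌F a∈)) (out b∉ b∌F)
          c = proj₁ (proj₂ route)
          start : a ∈ cut ⊎ Side a → Side a × a ∉ F
          start (inj₁ p) = ⊥-elim (a∉ p)
          start (inj₂ s) = s , Y∌F a∈
          stays : ∀ {u v} → v ∈ proj₁ route → Side u × u ∉ F → E u v → Side v × v ∉ F
          stays {u} {v} v∈ (s , u∉F) uv with proj₂ (proj₂ route) v∈
          ... | v∉ with closed s (∈-filter⁺ free? (∈-cartesianProduct⁺ (complete u) (complete v)) (uv , u∉F , v∉ ∘ ∈-++⁺ʳ cut))
          ...   | inj₁ p = ⊥-elim (v∉ (∈-++⁺ˡ p))
          ...   | inj₂ s′ = s′ , v∉ ∘ ∈-++⁺ʳ cut

      conclude : Linkage (ArcIn arcs) Y (tabulate o) k ⊎ Separation (ArcIn arcs) Y (tabulate o) k → Crossing Y o F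
      conclude (inj₂ sep) = ⊥-elim (separated sep)
      conclude (inj₁ l) = record
        { from = from ∘ τ⁻¹ ; path = path ∘ τ⁻¹ ; from∈ = from∈ ∘ τ⁻¹
        ; chain = λ i → subst (λ v → Chain E (from (τ⁻¹ i)) v (path (τ⁻¹ i)))
            (trans (o∘τ (τ⁻¹ i)) (cong o (τ∘τ⁻¹ i))) (Chain-map (proj₁ ∘ free) (chain (τ⁻¹ i)))
        ; avoids = λ i → Chain-preserves {P = _∉ F} (chain (τ⁻¹ i)) (Y∌F (from∈ (τ⁻¹ i))) (λ _ _ e → proj₂ (proj₂ (free e)))
        ; disjoint = λ i j w p q →
            trans (sym (τ∘τ⁻¹ i)) (trans (cong τ (disjoint _ _ w p q)) (τ∘τ⁻¹ j)) }
        where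
          open Linkage l
          -- The ends of the disjoint paths are `k` distinct vertices among the `o i`, hence all of
          -- them, and the paths are renumbered by their ends. The order of the starts is whatever
          -- results.
          τ : Fin k → Fin k
          τ i = proj₁ (∈-tabulate⁻ (to∈ i))
          o∘τ : ∀ i → to i ≡ o (τ i)
          o∘τ i = proj₂ (∈-tabulate⁻ (to∈ i))
          τ-injective : ∀ i j → τ i ≡ τ j → i ≡ j
          τ-injective i j eq = disjoint i j (to i) (Chain-last (chain i))
            (subst (_∈ path j) (trans (o∘τ j) (trans (cong o (sym eq)) (sym (o∘τ i)))) (Chain-last (chain j)))
          inverse : ∀ c → ∃ λ i → τ i ≡ c
          inverse = injective⇒surjective τ τ-injective
          τ⁻¹ : Fin k → Fin k
          τ⁻¹ = proj₁ ∘ inverse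
          τ∘τ⁻¹ : ∀ i → τ (τ⁻¹ i) ≡ i
          τ∘τ⁻¹ = proj₂ ∘ inverse

  -- The ends are kept out of `inner`: in both uses they belong to `F`, which the inner vertices
  -- avoid.
  record Legs (u v : Fin k → V) (F : List V) : Set where
    field
      inner    : Fin k → List V
      within   : ∀ i → Within E (u i) (v i) (u i ∷ v i ∷ inner i)
      avoids   : ∀ i {w} → w ∈ inner i → w ∉ F
      disjoint : Disjoint inner
      size     : length (concat (tabulate inner)) ≤ 2 ·k

  legs : ∀ {u v} F b → length F ≤ b ·k →
         (∀ i F′ → F ⊆ F′ → length F′ ≤ (b + 2) ·k → ∃ λ l → length l ≤ 2 ×
            Within E (u i) (v i) (u i ∷ v i ∷ l) × (∀ {w} → w ∈ l → w ∉ F′)) →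
         Legs u v F
  legs F b F≤ search = wrap (greedy k F (plus b 2 F≤ (≤-reflexive (sym (·k≡ 2)))) search)
    where
      wrap : _ → Legs _ _ F
      wrap (l , within , avoids , disjoint , size) = record
        { inner = l ; within = within ; avoids = avoids ; disjoint = disjoint
        ; size = ≤-trans size (≤-reflexive (sym (·k≡ 2))) }

  -- Assembling the disjoint paths.

  module Assembly {x y : Fin k → V}
    (x-inj : ∀ i j → x i ≡ x j → i ≡ j) (y-inj : ∀ i j → y i ≡ y j → i ≡ j) (x≢y : ∀ i j → x i ≢ y j)
    where

    Z : List V
    Z = tabulate x ++ tabulate y

    x∈Z : ∀ i → x i ∈ Z
    x∈Z i = ∈-++⁺ˡ (∈-tabulate⁺ i)

    y∈Z : ∀ i → y i ∈ Z
    y∈Z i = ∈-++⁺ʳ (tabulate x) (∈-tabulate⁺ i)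

    Z-size : length Z ≤ 2 ·k
    Z-size = ++-size (tabulate x) (tabulate y) 1 1 (tabulate-size x) (tabulate-size y)

    module _ (h : Hub Z) (e : Exits (Z ++ Hub.L h)) where

      open Hub h
      open Exits e

      F₀ : List V
      F₀ = (Z ++ L) ++ tabulate o

      Z⊆F₀ : Z ⊆ F₀
      Z⊆F₀ = ∈-++⁺ˡ ∘ ∈-++⁺ˡ

      L⊆F₀ : L ⊆ F₀
      L⊆F₀ = ∈-++⁺ˡ ∘ ∈-++⁺ʳ Z

      o∈F₀ : ∀ i → o i ∈ F₀
      o∈F₀ i = ∈-++⁺ʳ (Z ++ L) (∈-tabulate⁺ i)

      F₀-size : length F₀ ≤ 37 ·k
      F₀-size = ++-size (Z ++ L) (tabulate o) 36 1 (++-size Z L 2 34 Z-size L-size) (tabulate-size o)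

      -- Here 153 = 3 · 39 + 34 + 2, with 39 = 37 + 2 for the forbidden vertices during the choice
      -- and 34 for `I`.
      entering : Legs x X F₀
      entering = legs F₀ 37 F₀-size λ i F F₀⊆ F≤ →
        let l , short , path , avoid = shortPath I F uall (F₀⊆ (Z⊆F₀ (x∈Z i))) (F₀⊆ (L⊆F₀ (X∈L i)))
              (λ _ w∉ → I-top w∉ (L⊆I (X∈L i)))
              (≤-trans (budget 39 34 F≤ I-size) (≤-trans (lit 153 200) (degree⁺ (x i))))
        in l , short , path , proj₂ ∘ avoid

      module _ (a : Legs x X F₀) where

        private module a = Legs a

        -- These are short paths from `y i` to `o i` in the reversed digraph, turned around. Here
        -- 162 = 3 · 41 + 37 + 2, with 37 for `O`.
        leaving : Legs o y (F₀ ++ concat (tabulate a.inner))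
        leaving = legs _ 39 (++-size F₀ (concat (tabulate a.inner)) 37 2 F₀-size a.size) λ i F F₁⊆ F≤ →
          let l , short , (_ , path , path⊆) , avoid =
                Op.shortPath O F uall (F₁⊆ (∈-++⁺ˡ (Z⊆F₀ (y∈Z i)))) (F₁⊆ (∈-++⁺ˡ (o∈F₀ i)))
                  (λ _ w∉ → O-top w∉ (o∈O i))
                  (≤-trans (budget 41 37 F≤ O-size) (≤-trans (lit 162 200) (degree⁻ (y i))))
              us , c , us⊆ = Chain-reverse {E = E} path
          in l , short , (us , c , exchange ∘ path⊆ ∘ us⊆) , proj₂ ∘ avoid
          where
            exchange : ∀ {u v} {l : List V} → u ∷ v ∷ l ⊆ v ∷ u ∷ l
            exchange (here p) = there (here p)
            exchange (there (here p)) = here p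
            exchange (there (there p)) = there (there p)

        module _ (b : Legs o y (F₀ ++ concat (tabulate a.inner))) where

          private module b = Legs b

          ab : List V
          ab = concat (tabulate a.inner) ++ concat (tabulate b.inner)

          -- `Y` and the `o i` stay available as ends of the crossing paths. Deleting `L ∖ Y` keeps
          -- these paths off the `X i` and off the inner vertices that `linker` supplies.
          F : List V
          F = (Z ++ (L ∖ Y)) ++ ab

          ab-avoids : ∀ {w} → w ∈ ab → w ∉ F₀
          ab-avoids p q = [ (λ p → let i , p′ = concat-tabulate⁻ a.inner p in a.avoids i p′ q)
                          , (λ p → let i , p′ = concat-tabulate⁻ b.inner p in b.avoids i p′ (∈-++⁺ˡ q)) ]′
                          (∈-++⁻ (concat (tabulate a.inner)) p)

          outside-F : ∀ {w} → w ∉ Z → w ∉ L ∖ Y → w ∈ F₀ → w ∉ F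
          outside-F p q r s = [ [ p , q ]′ ∘ ∈-++⁻ Z , (λ s → ab-avoids s r) ]′ (∈-++⁻ (Z ++ (L ∖ Y)) s)

          Z⊆F : Z ⊆ F
          Z⊆F = ∈-++⁺ˡ ∘ ∈-++⁺ˡ

          L∖Y⊆F : ∀ {w} → w ∈ L → w ∉ Y → w ∈ F
          L∖Y⊆F p q = ∈-++⁺ˡ (∈-++⁺ʳ Z (∈-∖⁺ Y p q))

          a⊆F : ∀ i → a.inner i ⊆ F
          a⊆F i = ∈-++⁺ʳ (Z ++ (L ∖ Y)) ∘ ∈-++⁺ˡ ∘ ∈-concat-tabulate a.inner i

          b⊆F : ∀ i → b.inner i ⊆ F
          b⊆F i = ∈-++⁺ʳ (Z ++ (L ∖ Y)) ∘ ∈-++⁺ʳ (concat (tabulate a.inner)) ∘ ∈-concat-tabulate b.inner i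

          long : Crossing Y o F
          long = crossing Y o F Y-unique Y-size o-inj
            (++-size (Z ++ (L ∖ Y)) ab 36 4
              (++-size Z (L ∖ Y) 2 34 Z-size (≤-trans (length-filter _ L) L-size))
              (++-size (concat (tabulate a.inner)) (concat (tabulate b.inner)) 2 2 a.size b.size))
            (λ w∈ → outside-F (L∌Z (Y⊆L w∈)) (λ p → proj₂ (∈-∖⁻ L Y p) w∈) (L⊆F₀ (Y⊆L w∈)))
            (λ i → outside-F (o∉F i ∘ ∈-++⁺ˡ) (o∉F i ∘ ∈-++⁺ʳ Z ∘ proj₁ ∘ ∈-∖⁻ L Y) (o∈F₀ i))

          module _ (Q : Crossing Y o F) where

            private module Q = Crossing Q

            -- Route `i` runs from `x i` to `X i`, inside `L` to `Q.from i`, along the crossing path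
            -- to `o i`, and on to `y i`.
            assemble : (Σ (Fin k → List V) λ c → (∀ i → Within E (X i) (Q.from i) (X i ∷ Q.from i ∷ c i)) ×
                         (∀ i {w} → w ∈ c i → w ∈ L × w ∉ tabulate X ++ Y) × Disjoint c) →
                       Σ (Fin k → List V) λ P → (∀ i → Within E (x i) (y i) (P i)) × Disjoint P
            assemble (c , c-within , c-place , c-disjoint) = P , within , P-disjoint
              where
                -- Each further piece costs one `Disjoint-++`. The vertices `Q.from i` and `o i` are
                -- covered by `Q.path i`.
                xs Xs ys P₁ P₂ P₃ P₄ P₅ P : Fin k → List V
                xs i = x i ∷ []
                Xs i = X i ∷ []
                ys i = y i ∷ []
                P₁ i = xs i ++ ys i
                P₂ i = P₁ i ++ a.inner i
                P₃ i = P₂ i ++ b.inner i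
                P₄ i = P₃ i ++ Xs i
                P₅ i = P₄ i ++ c i
                P i = P₅ i ++ Q.path i

                within : ∀ i → Within E (x i) (y i) (P i)
                within i =
                  let us , d , us⊆ = Within-trans (Within-trans (Within-trans (a.within i) (c-within i))
                                       (Q.path i , Q.chain i , λ p → p)) (b.within i)
                  in us , d , collect ∘ us⊆
                  where
                    P₄⊆ : P₄ i ⊆ P i
                    P₄⊆ = ∈-++⁺ˡ {xs = P₅ i} ∘ ∈-++⁺ˡ {xs = P₄ i}
                    P₃⊆ : P₃ i ⊆ P i
                    P₃⊆ = P₄⊆ ∘ ∈-++⁺ˡ {xs = P₃ i}
                    P₂⊆ : P₂ i ⊆ P i
                    P₂⊆ = P₃⊆ ∘ ∈-++⁺ˡ {xs = P₂ i}
                    P₁⊆ : P₁ i ⊆ P i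
                    P₁⊆ = P₂⊆ ∘ ∈-++⁺ˡ {xs = P₁ i}
                    X∈P : X i ∈ P i
                    X∈P = P₄⊆ (∈-++⁺ʳ (P₃ i) (here refl))
                    Q⊆P : Q.path i ⊆ P i
                    Q⊆P = ∈-++⁺ʳ (P₅ i)
                    legs⊆ : ∀ {u v l} → u ∈ P i → v ∈ P i → l ⊆ P i → u ∷ v ∷ l ⊆ P i
                    legs⊆ u∈ v∈ l⊆ (here refl) = u∈
                    legs⊆ u∈ v∈ l⊆ (there (here refl)) = v∈
                    legs⊆ u∈ v∈ l⊆ (there (there p)) = l⊆ p
                    either : ∀ {vs ws} → vs ⊆ P i → ws ⊆ P i → vs ++ ws ⊆ P i
                    either {vs} vs⊆ ws⊆ p = [ vs⊆ , ws⊆ ]′ (∈-++⁻ vs p)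
                    collect : (((x i ∷ X i ∷ a.inner i) ++ (X i ∷ Q.from i ∷ c i)) ++ Q.path i) ++
                              (o i ∷ y i ∷ b.inner i) ⊆ P i
                    collect = either (either (either
                      (legs⊆ (P₁⊆ (here refl)) X∈P (P₂⊆ ∘ ∈-++⁺ʳ (P₁ i)))
                      (legs⊆ X∈P (Q⊆P (Chain-head (Q.chain i))) (∈-++⁺ˡ {xs = P₅ i} ∘ ∈-++⁺ʳ (P₄ i))))
                      Q⊆P)
                      (legs⊆ (Q⊆P (Chain-last (Q.chain i))) (P₁⊆ (there (here refl)))
                        (P₃⊆ ∘ ∈-++⁺ʳ (P₂ i)))

                in-Z : ∀ i {w} → w ∈ P₁ i → w ∈ Z
                in-Z i (here refl) = x∈Z i
                in-Z i (there (here refl)) = y∈Z i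

                P-disjoint : Disjoint P
                P-disjoint =
                  Disjoint-++ {P = P₅} {Q.path}
                    (Disjoint-++ {P = P₄} {c}
                      (Disjoint-++ {P = P₃} {Xs}
                        (Disjoint-++ {P = P₂} {b.inner}
                          (Disjoint-++ {P = P₁} {a.inner}
                            (Disjoint-++ {P = xs} {ys} (Disjoint-singleton x-inj) (Disjoint-singleton y-inj)
                              (λ { i j (here refl) (here eq) → x≢y i j eq }))
                            a.disjoint
                            (λ i j p q → a.avoids j q (Z⊆F₀ (in-Z i p))))
                          b.disjoint
                          (Apart-++ {P = P₁} {a.inner}
                            (λ i j p q → b.avoids j q (∈-++⁺ˡ (Z⊆F₀ (in-Z i p))))
                            (λ i j p q → b.avoids j q (∈-++⁺ʳ F₀ (∈-concat-tabulate a.inner i p)))))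
                        (Disjoint-singleton X-inj)
                        (beforeHub Xs λ { j (here refl) → X∈L j }))
                      c-disjoint
                      (Apart-++ {P = P₃} {Xs}
                        (beforeHub c λ j q → proj₁ (c-place j q))
                        (λ { i j (here refl) q → proj₂ (c-place j q) (∈-++⁺ˡ (∈-tabulate⁺ i)) })))
                    Q.disjoint
                    (Apart-++ {P = P₄} {c} (Apart-++ {P = P₃} {Xs} (Apart-++ {P = P₂} {b.inner} (Apart-++ {P = P₁} {a.inner}
                      (λ i j p q → Q.avoids j q (Z⊆F (in-Z i p)))
                      (λ i j p q → Q.avoids j q (a⊆F i p)))
                      (λ i j p q → Q.avoids j q (b⊆F i p)))
                      (λ { i j (here refl) q → Q.avoids j q (L∖Y⊆F (X∈L i) (X∉Y i)) }))
                      (λ i j p q → Q.avoids j q (L∖Y⊆F (proj₁ (c-place i p)) (proj₂ (c-place i p) ∘ ∈-++⁺ʳ (tabulate X)))))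
                  where
                    beforeHub : ∀ R → (∀ j {w} → w ∈ R j → w ∈ L) → Apart P₃ R
                    beforeHub R R⊆L = Apart-++ {P = P₂} {b.inner} (Apart-++ {P = P₁} {a.inner}
                      (λ i j p q → L∌Z (R⊆L j q) (in-Z i p))
                      (λ i j p q → a.avoids i p (L⊆F₀ (R⊆L j q))))
                      (λ i j p q → b.avoids i p (∈-++⁺ˡ (L⊆F₀ (R⊆L j q))))

  link : (x y : Fin k → V) → (∀ i j → x i ≡ x j → i ≡ j) → (∀ i j → y i ≡ y j → i ≡ j) →
         (∀ i j → x i ≢ y j) →
         Σ (Fin k → List V) λ P → (∀ i → Within E (x i) (y i) (P i)) × Disjoint P
  -- `linker` is applied last, since the starts of the crossing paths are known only from Menger's
  -- theorem.
  link x y x-inj y-inj x≢y = assemble h e a b Q (linker h (Crossing.from Q) (Crossing.from∈ Q))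
    where
      open Assembly x-inj y-inj x≢y
      h = hub Z Z-size
      e = exits (Z ++ Hub.L h) (++-size Z (Hub.L h) 2 34 Z-size (Hub.L-size h))
      a = entering h e
      b = leaving h e a
      Q = long h e a b

-- From walks to paths, and from lists and relations to the notions of the theorem.

module _ {V : Set} (_≟_ : DecidableEquality V) {E : V → V → Set} where

  open DecMembership _≟_ using (_∈?_)

  Chain-drop : ∀ {x y z vs} → Chain E x y vs → Unique vs → z ∈ vs →
               ∃ λ us → Chain E z y us × Unique us × us ⊆ vs
  Chain-drop c u (here refl) with c
  ... | [ _ ] = _ , c , u , λ p → p
  ... | _ ∷ _ = _ , c , u , λ p → p
  Chain-drop (_ ∷ c) (_ ∷ u) (there p) with Chain-drop c u p
  ... | us , d , u′ , us⊆ = us , d , u′ , there ∘ us⊆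

  -- If `x` recurs in the simplified rest, that rest is entered at the recurrence and the detour
  -- before it is dropped.
  Chain-simplify : ∀ {x y vs} → Chain E x y vs → ∃ λ us → Chain E x y us × Unique us × us ⊆ vs
  Chain-simplify [ x ] = _ , [ x ] , [] ∷ [] , λ p → p
  Chain-simplify {x} (e ∷ c) with Chain-simplify c
  ... | us , d , u , us⊆ with x ∈? us
  ...   | no x∉ = x ∷ us , e ∷ d , ¬Any⇒All¬ us x∉ ∷ u ,
                  λ { (here p) → here p ; (there p) → there (us⊆ p) }
  ...   | yes x∈ with Chain-drop d u x∈
  ...     | ws , d′ , u′ , ws⊆ = ws , d′ , u′ , there ∘ us⊆ ∘ ws⊆

module _ {n : ℕ} where

  fromList : List (Fin n) → Subset n
  fromList [] = Sub.⊥
  fromList (v ∷ vs) = Sub.⁅ v ⁆ Sub.∪ fromList vs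

  ∈-fromList⁺ : ∀ {w} vs → w ∈ vs → w Sub.∈ fromList vs
  ∈-fromList⁺ (v ∷ vs) (here refl) = Subₚ.x∈p∪q⁺ (inj₁ (Subₚ.x∈⁅x⁆ v))
  ∈-fromList⁺ (v ∷ vs) (there p) = Subₚ.x∈p∪q⁺ (inj₂ (∈-fromList⁺ vs p))

  ∈-fromList⁻ : ∀ {w} vs → w Sub.∈ fromList vs → w ∈ vs
  ∈-fromList⁻ [] p = ⊥-elim (Subₚ.∉⊥ p)
  ∈-fromList⁻ (v ∷ vs) p with Subₚ.x∈p∪q⁻ Sub.⁅ v ⁆ (fromList vs) p
  ... | inj₁ q = here (Subₚ.x∈⁅y⁆⇒x≡y v q)
  ... | inj₂ q = there (∈-fromList⁻ vs q)

∣p∪q∣≤∣p∣+∣q∣ : ∀ {n} (p q : Subset n) → ∣ p Sub.∪ q ∣ ≤ ∣ p ∣ + ∣ q ∣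
∣p∪q∣≤∣p∣+∣q∣ [] [] = z≤n
∣p∪q∣≤∣p∣+∣q∣ (false ∷ p) (false ∷ q) = ∣p∪q∣≤∣p∣+∣q∣ p q
∣p∪q∣≤∣p∣+∣q∣ (false ∷ p) (true ∷ q) = ≤-trans (s≤s (∣p∪q∣≤∣p∣+∣q∣ p q)) (≤-reflexive (sym (+-suc _ _)))
∣p∪q∣≤∣p∣+∣q∣ (true ∷ p) (false ∷ q) = s≤s (∣p∪q∣≤∣p∣+∣q∣ p q)
∣p∪q∣≤∣p∣+∣q∣ (true ∷ p) (true ∷ q) = s≤s (≤-trans (∣p∪q∣≤∣p∣+∣q∣ p q) (+-monoʳ-≤ _ (n≤1+n _)))

∣fromList∣≤length : ∀ {n} (vs : List (Fin n)) → ∣ fromList vs ∣ ≤ length vs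
∣fromList∣≤length {n} [] = ≤-reflexive (Subₚ.∣⊥∣≡0 n)
∣fromList∣≤length (v ∷ vs) = ≤-trans (∣p∪q∣≤∣p∣+∣q∣ Sub.⁅ v ⁆ (fromList vs))
  (+-mono-≤ (≤-reflexive (Subₚ.∣⁅x⁆∣≡1 v)) (∣fromList∣≤length vs))

module _ {n : ℕ} {D : Digraph n} where

  Walk⇒Chain : ∀ {x y vs} → Walk D x y vs → Chain (Arc D) x y vs
  Walk⇒Chain (here x) = [ x ]
  Walk⇒Chain (step e w) = e ∷ Walk⇒Chain w

  Chain⇒Walk : ∀ {x y vs} → Chain (Arc D) x y vs → Walk D x y vs
  Chain⇒Walk [ x ] = here x
  Chain⇒Walk (e ∷ c) = step e (Chain⇒Walk c)

  tournament-irreflexive : IsTournament D → ∀ {u} → ¬ Arc D u u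
  tournament-irreflexive (loopless , _) {u} = subst T (loopless u)

  tournament-total : IsTournament D → ∀ {u v} → u ≢ v → Arc D u v ⊎ Arc D v u
  tournament-total (_ , complete) {u} {v} u≢v with D u v | D v u | complete u v u≢v
  ... | true | _ | _ = inj₁ _
  ... | false | true | _ = inj₂ _

  -- Repetitions in the list `S` only make the deleted set smaller than `length S`, so the deletion
  -- is permitted.
  stronglyConnected⇒Connected : ∀ {le : ℕ → Set} {m} → StronglyConnected D le →
                                (∀ {t} → t ≤ m → le t) → Connected (Arc D) m
  stronglyConnected⇒Connected {m = m} (_ , conn) le-small S {u} {v} S< u∉ v∉ =
    let vs , (w , _) , avoid = conn (fromList S) (le-small size) u v (u∉ ∘ ∈-fromList⁻ S) (v∉ ∘ ∈-fromList⁻ S)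
    in vs , Walk⇒Chain w , λ p → All.lookup avoid p ∘ ∈-fromList⁺ S
    where
      size : ∣ fromList S ∣ + 1 ≤ m
      size = ≤-trans (≤-reflexive (+-comm _ 1)) (≤-trans (s≤s (∣fromList∣≤length S)) S<)

  stronglyConnected⇒order : ∀ {le : ℕ → Set} {m} → StronglyConnected D le →
                            (∀ {t} → t ≤ m → le t) → m < n
  stronglyConnected⇒order (large , _) le-small = ≰⇒> (large ∘ le-small)

^-mono-≤ : ∀ {k t m} → 2 ≤ k → t ≤ m → 2 ^ t ≤ k ^ m
^-mono-≤ {m = m} 2≤k t≤m = ≤-trans (^-monoʳ-≤ 2 t≤m) (^-monoˡ-≤ m 2≤k)

theorem1p3 : ∀ (k : ℕ) → 2 ≤ k → ∀ (n : ℕ) (D : Digraph n) →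
    IsTournament D → StronglyConnected D (LeThreshold k) → Linked D k
theorem1p3 k 2≤k n D tournament strong = <⇒≤ (≤-trans (s≤s (*-monoˡ-≤ k (≤ᵇ⇒≤ 2 200 _))) order) , linked
  where
    -- Since `2 ≤ k`, log k is at least 1, so the connectivity `200 * k` is below the threshold.
    small : ∀ {t} → t ≤ 200 * k → LeThreshold k t
    small t≤ = ^-mono-≤ 2≤k (≤-trans t≤ (*-monoˡ-≤ k (≤ᵇ⇒≤ 200 10000 _)))

    order : 200 * k < n
    order = stronglyConnected⇒order {D = D} strong small

    open Linking Fin._≟_ {Arc D} (λ u v → T? (D u v))
      (tournament-irreflexive {D = D} tournament) (tournament-total {D = D} tournament)
      (allFin n) ∈-allFin (Uniqueₚ.allFin⁺ n) k (<⇒≤ 2≤k)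
      (subst (200 * k <_) (sym (length-tabulate {n = n} (λ i → i))) order)
      (stronglyConnected⇒Connected {D = D} strong small)

    linked : ∀ (x y : Fin k → Fin n) → (∀ i j → x i ≡ x j → i ≡ j) → (∀ i j → y i ≡ y j → i ≡ j) →
             (∀ i j → x i ≢ y j) → Σ (Fin k → List (Fin n)) λ P →
             (∀ i → IsPath D (x i) (y i) (P i)) × (∀ i j w → w ∈ P i → w ∈ P j → i ≡ j)
    linked x y x-inj y-inj x≢y = conclude (link x y x-inj y-inj x≢y)
      where
        conclude : (Σ (Fin k → List (Fin n)) λ P → (∀ i → Within (Arc D) (x i) (y i) (P i)) × Disjoint P) → _
        conclude (P , within , disjoint) =
          (λ i → proj₁ (simple i)) ,
          (λ i → let _ , c , u , _ = simple i in Chain⇒Walk c , u) ,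
          λ i j w p q → disjoint i j w (us⊆P i p) (us⊆P j q)
          where
            simple : ∀ i → ∃ λ us → Chain (Arc D) (x i) (y i) us × Unique us × us ⊆ proj₁ (within i)
            simple i = Chain-simplify Fin._≟_ (proj₁ (proj₂ (within i)))
            us⊆P : ∀ i → proj₁ (simple i) ⊆ P i
            us⊆P i p = proj₂ (proj₂ (within i)) (proj₂ (proj₂ (proj₂ (simple i))) p)
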